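{- $\mathsf{ZF}$ proves that if $\mathbb P$ is a $\mathrm{CCC}_3$ notion of forcing, then for every $V$-generic filter $G\subseteq\mathbb P$, Bukovský's condition holds for $V\subseteq V[G]$ with $\kappa=\aleph_1$; that is, for every $x\in V$ and every function $f\colon x\to V$ in $V[G]$, there is a function $g\colon x\to V$ in $V$ such that for all $u\in x$, $V\models |g(u)|<\aleph_1$ and $V[G]\models f(u)\in g(u)$.
   Context: A notion of forcing is a preordered set $\mathbb P$ with a maximum. Conditions are compatible if they have a common extension. $D\subseteq\mathbb P$ is predense if every $p\in\mathbb P$ is compatible with some member of $D$. $\mathbb P$ is $\mathrm{CCC}_3$ if every predense subset of $\mathbb P$ contains a countable predense subset. $|g(u)|<\aleph_1$ means that $g(u)$ is a countable set (possibly finite). -}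

module Defs where

open import Level using (Level; suc)
open import Data.Nat using (ℕ) renaming (suc to 1+)
open import Data.Fin using (Fin)
open import Data.Vec using (Vec; _∷_; lookup)
open import Data.Empty.Polymorphic using (⊥)
open import Data.Product using (Σ-syntax; ∃-syntax; _×_)
open import Data.Sum using (_⊎_)
open import Function.Bundles using (_⇔_)
open import Relation.Binary using (Rel; IsEquivalence; _Respects_; _Respects₂_)
open import Relation.Nullary using (¬_)
open import Relation.Unary using (Pred)

private
  variable
    ℓ : Level
    n : ℕ

-- First-order structures for the language {∈, =}.  Equality is interpreted by
-- a congruence, since quotients are not available.

record Structure (ℓ : Level) : Set (suc ℓ) where
  infix 4 _≈_ _∈_
  field
    Carrier       : Set ℓ
    _≈_           : Rel Carrier ℓ
    isEquivalence : IsEquivalence _≈_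
    _∈_           : Rel Carrier ℓ
    ∈-resp-≈      : _∈_ Respects₂ _≈_

open Structure using (Carrier)

-- First-order formulas with n free variables (de Bruijn indices).

data Formula : ℕ → Set where
  _∈′_ _≈′_      : Fin n → Fin n → Formula n
  ⊥′             : Formula n
  _⇒′_ _∧′_ _∨′_ : Formula n → Formula n → Formula n
  ∀′_ ∃′_        : Formula (1+ n) → Formula n

module SetTheory {ℓ : Level} (S : Structure ℓ) where

  open Structure S using (_≈_; _∈_)

  U : Set ℓ
  U = Carrier S

  infix 3 _⊨_
  _⊨_ : Vec U n → Formula n → Set ℓ
  ρ ⊨ (i ∈′ j) = lookup ρ i ∈ lookup ρ j
  ρ ⊨ (i ≈′ j) = lookup ρ i ≈ lookup ρ j
  ρ ⊨ ⊥′       = ⊥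
  ρ ⊨ (φ ⇒′ ψ) = (ρ ⊨ φ) → (ρ ⊨ ψ)
  ρ ⊨ (φ ∧′ ψ) = (ρ ⊨ φ) × (ρ ⊨ ψ)
  ρ ⊨ (φ ∨′ ψ) = (ρ ⊨ φ) ⊎ (ρ ⊨ ψ)
  ρ ⊨ (∀′ φ)   = ∀ x → x ∷ ρ ⊨ φ
  ρ ⊨ (∃′ φ)   = ∃[ x ] (x ∷ ρ ⊨ φ)

  infix 4 _⊆_
  _⊆_ : U → U → Set ℓ
  x ⊆ y = ∀ z → z ∈ x → z ∈ y

  IsEmpty : U → Set ℓ
  IsEmpty x = ∀ z → ¬ (z ∈ x)

  IsPair : U → U → U → Set ℓ
  IsPair z a b = ∀ w → w ∈ z ⇔ (w ≈ a ⊎ w ≈ b)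

  -- z = {{a},{a,b}}
  IsOrderedPair : U → U → U → Set ℓ
  IsOrderedPair z a b =
    ∃[ s ] ∃[ t ] (IsPair s a a × IsPair t a b × IsPair z s t)

  infix 4 ⟨_,_⟩∈_
  ⟨_,_⟩∈_ : U → U → U → Set ℓ
  ⟨ a , b ⟩∈ r = ∃[ z ] (IsOrderedPair z a b × z ∈ r)

  IsSuccessor : U → U → Set ℓ
  IsSuccessor y x = ∀ w → w ∈ y ⇔ (w ∈ x ⊎ w ≈ x)

  IsInductive : U → Set ℓ
  IsInductive x =
      (∃[ e ] (IsEmpty e × e ∈ x))
    × (∀ y → y ∈ x → ∃[ s ] (IsSuccessor s y × s ∈ x))

  IsOmega : U → Set ℓ
  IsOmega w = IsInductive w × (∀ i → IsInductive i → w ⊆ i)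

  record IsFunctionOn (f x : U) : Set ℓ where
    field
      relation : ∀ z → z ∈ f → ∃[ a ] ∃[ b ] (a ∈ x × IsOrderedPair z a b)
      total    : ∀ a → a ∈ x → ∃[ b ] ⟨ a , b ⟩∈ f
      unique   : ∀ a b b′ → ⟨ a , b ⟩∈ f → ⟨ a , b′ ⟩∈ f → b ≈ b′

  record IsInjection (f x y : U) : Set ℓ where
    field
      isFunctionOn : IsFunctionOn f x
      range        : ∀ a b → ⟨ a , b ⟩∈ f → b ∈ y
      injective    : ∀ a a′ b → ⟨ a , b ⟩∈ f → ⟨ a′ , b ⟩∈ f → a ≈ a′

  Countable : U → Set ℓ
  Countable x = ∃[ ω ] ∃[ f ] (IsOmega ω × IsInjection f x ω)

  record IsZF : Set ℓ where
    field
      extensionality : ∀ x y → (∀ z → z ∈ x ⇔ z ∈ y) → x ≈ y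
      foundation     : ∀ x → ∃[ y ] (y ∈ x) →
                       ∃[ y ] (y ∈ x × (∀ z → z ∈ x → ¬ (z ∈ y)))
      pairing        : ∀ a b → ∃[ z ] IsPair z a b
      union          : ∀ x → ∃[ y ] (∀ z → z ∈ y ⇔ (∃[ w ] (w ∈ x × z ∈ w)))
      powerset       : ∀ x → ∃[ y ] (∀ z → z ∈ y ⇔ z ⊆ x)
      infinity       : ∃[ x ] IsInductive x
      separation     : ∀ {n} (φ : Formula (1+ n)) (ρ : Vec U n) x →
                       ∃[ y ] (∀ z → z ∈ y ⇔ (z ∈ x × (z ∷ ρ ⊨ φ)))
      replacement    : ∀ {n} (φ : Formula (1+ (1+ n))) (ρ : Vec U n) x →
                       (∀ a b b′ → a ∈ x →
                          (a ∷ b ∷ ρ ⊨ φ) → (a ∷ b′ ∷ ρ ⊨ φ) → b ≈ b′) →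
                       ∃[ y ] (∀ b → b ∈ y ⇔
                                 (∃[ a ] (a ∈ x × (a ∷ b ∷ ρ ⊨ φ))))

  -- τ is a P-name iff every element of τ is of the form ⟨σ,p⟩ with σ a P-name
  -- and p ∈ P.  By foundation this ∈-recursion amounts to τ lying in some set
  -- t closed under it.
  IsName : U → U → Set ℓ
  IsName P τ =
    ∃[ t ] (τ ∈ t ×
      (∀ s → s ∈ t → ∀ z → z ∈ s →
         ∃[ σ ] ∃[ p ] (σ ∈ t × p ∈ P × IsOrderedPair z σ p)))

  -- w = τ^G, where τ^G = {σ^G : ⟨σ,p⟩ ∈ τ for some p ∈ G}: the recursion is
  -- witnessed by a function h satisfying it on a set d ∋ τ containing all
  -- names occurring hereditarily in τ.
  IsValue : U → U → U → Set ℓ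
  IsValue G τ w =
    ∃[ d ] ∃[ h ]
      ( (∀ s σ p → s ∈ d → ⟨ σ , p ⟩∈ s → σ ∈ d)
      × IsFunctionOn h d
      × (∀ s y → ⟨ s , y ⟩∈ h → ∀ v →
           v ∈ y ⇔ (∃[ σ ] ∃[ p ] (⟨ σ , p ⟩∈ s × p ∈ G × ⟨ σ , v ⟩∈ h)))
      × τ ∈ d
      × ⟨ τ , w ⟩∈ h)

open SetTheory using (IsZF)

-- A notion of forcing belonging to the model V; ⟨p,q⟩ ∈ leq says that p is
-- stronger than q.

record ForcingNotion (V : Structure ℓ) : Set ℓ where
  open Structure V using (_∈_)
  open SetTheory V using (U; IsOrderedPair; ⟨_,_⟩∈_; _⊆_; Countable)
  field
    P leq 𝟙 : U

  infix 4 _≤_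
  _≤_ : U → U → Set ℓ
  p ≤ q = ⟨ p , q ⟩∈ leq

  field
    relation : ∀ z → z ∈ leq →
               ∃[ p ] ∃[ q ] (p ∈ P × q ∈ P × IsOrderedPair z p q)
    ≤-refl   : ∀ p → p ∈ P → p ≤ p
    ≤-trans  : ∀ p q r → p ≤ q → q ≤ r → p ≤ r
    𝟙∈P      : 𝟙 ∈ P
    maximum  : ∀ p → p ∈ P → p ≤ 𝟙

  Compatible : U → U → Set ℓ
  Compatible p q = ∃[ r ] (r ∈ P × r ≤ p × r ≤ q)

  Dense : U → Set ℓ
  Dense D = D ⊆ P × (∀ p → p ∈ P → ∃[ d ] (d ∈ D × d ≤ p))

  Predense : U → Set ℓ
  Predense D = D ⊆ P × (∀ p → p ∈ P → ∃[ d ] (d ∈ D × Compatible p d))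

  CCC₃ : Set ℓ
  CCC₃ = ∀ D → Predense D → ∃[ C ] (C ⊆ D × Countable C × Predense C)

-- G is a subset of P that need not belong to V.

record IsGenericFilter (V : Structure ℓ) (ℙ : ForcingNotion V)
                       (G : Pred (Carrier V) ℓ) : Set ℓ where
  open Structure V using (_≈_; _∈_)
  open ForcingNotion ℙ
  field
    resp-≈   : G Respects _≈_
    subset   : ∀ p → G p → p ∈ P
    nonempty : ∃[ p ] G p
    upward   : ∀ p q → G p → p ≤ q → G q
    directed : ∀ p q → G p → G q → ∃[ r ] (G r × r ≤ p × r ≤ q)
    generic  : ∀ D → Dense D → ∃[ p ] (p ∈ D × G p)

-- V ⊆ W, with W a model of ZF in which V is a transitive class; V is
-- identified with its image under ι.

record Extension (V : Structure ℓ) : Set (suc ℓ) where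
  private module V = Structure V
  field
    W    : Structure ℓ
    isZF : IsZF W
  private module W = Structure W
  field
    ι          : Carrier V → Carrier W
    ι-≈        : ∀ x y → x V.≈ y ⇔ ι x W.≈ ι y
    ι-∈        : ∀ x y → x V.∈ y ⇔ ι x W.∈ ι y
    transitive : ∀ w x → w W.∈ ι x → ∃[ y ] (w W.≈ ι y)

-- W = V[G]: G is an element of W, and W consists of the values τ^G of the
-- P-names τ in V.  (That every P-name in V has a value in W follows from
-- recursion in W.)

record GenericExtension (V : Structure ℓ) (ℙ : ForcingNotion V)
                        (G : Pred (Carrier V) ℓ) : Set (suc ℓ) where
  field
    extension : Extension V
  open Extension extension public
  open Structure W using (_≈_; _∈_)
  open ForcingNotion ℙ using (P)
  field
    Ĝ      : Carrier W
    Ĝ-spec : ∀ w → w ∈ Ĝ ⇔ (∃[ p ] (G p × w ≈ ι p))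
    values : ∀ w → ∃[ τ ] (SetTheory.IsName V P τ ×
                           SetTheory.IsValue W Ĝ (ι τ) w)

-- Bukovský's condition for V ⊆ W with κ = ℵ₁.

Bukovský-ℵ₁ : (V : Structure ℓ) → Extension V → Set ℓ
Bukovský-ℵ₁ V E =
  ∀ (x : Carrier V) (f : Carrier W) →
  W′.IsFunctionOn f (ι x) →
  (∀ u y → W′.⟨ u , y ⟩∈ f → ∃[ v ] (y W.≈ ι v)) →
  Σ[ g ∈ Carrier V ]
    ( V′.IsFunctionOn g x
    × (∀ u y → u V.∈ x → V′.⟨ u , y ⟩∈ g →
         V′.Countable y × (∀ b → W′.⟨ ι u , b ⟩∈ f → b W.∈ ι y)))
  where
  open Extension E
  module V  = Structure V
  module W  = Structure W
  module V′ = SetTheory V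
  module W′ = SetTheory W

{-# OPTIONS --safe #-}
module Submission where

-- Let f = τ^G.  For u ∈ x let g(u) be the set of all v such that some condition
-- settles f(u) = v, i.e. forces it and has no extension forcing another value.
-- No choice is needed to form g.  The conditions that settle f(u), together with
-- those having no extension that does, form a predense set; if C is a countable
-- predense subset, then a condition settling f(u) = v is compatible with some
-- c ∈ C, and c settles the same value.  So a subset of C maps onto g(u), which is
-- therefore countable, by least indices.  The true value of f(u) is settled by a
-- condition in G.
--
-- Forcing is needed only for σ = ž with σ a name and z ∈ V.

open import Defs
open import Axiom.ExcludedMiddle using (ExcludedMiddle)
open import Relation.Unary using (Pred)

open import Level using (Level)
open import Data.Empty using (⊥-elim)
open import Data.Fin using (Fin; zero; suc; lift; _↑ˡ_; _↑ʳ_)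
open import Data.Nat using (ℕ; zero; suc; _+_)
open import Data.Product using (∃; ∃-syntax; _×_; _,_; proj₁; proj₂)
open import Data.Product.Function.NonDependent.Propositional using (_×-⇔_)
open import Data.Sum using (_⊎_; inj₁; inj₂; [_,_]′)
open import Data.Sum.Function.Propositional using (_⊎-⇔_)
open import Data.Unit.Polymorphic using (⊤; tt)
open import Data.Vec using (Vec; []; _∷_; _++_; lookup)
open import Data.Vec.Properties using (lookup-++ˡ; lookup-++ʳ)
open import Function using (_∘_; id)
open import Function.Bundles using (_⇔_; mk⇔; Equivalence)
open import Function.Construct.Composition using (_⇔-∘_)
open import Function.Construct.Symmetry using (⇔-sym)
open import Relation.Binary using (IsEquivalence)
open import Relation.Binary.PropositionalEquality using (_≡_; refl; sym; trans; subst₂)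
open import Relation.Nullary using (¬_; yes; no)
open import Relation.Nullary.Decidable using (decidable-stable)

open Equivalence using (to; from)

-- Forcing σ = ž suffices because the elements of `f` are pairs in V: f(u) = v says that some ⟨π,q⟩
-- ∈ τ with q ∈ G has π^G = ⟨u,v⟩. The truth lemma for such statements is an ∈-induction on z, with
-- the names universally quantified at each stage. Two obstacles shape the development. Separation
-- and Replacement hold in the models only for formulas, so a predicate used to form a set must come
-- with a defining formula, built in parallel with it. Each inductive statement therefore has a
-- counterpart quantified over W, and the forcing relation enters it through a single set `e` of
-- triples.

private
  variable
    ℓ : Level
    n m k : ℕ

-- Logical equivalences and renaming of variables

→-⇔ : {A B C D : Set ℓ} → A ⇔ B → C ⇔ D → (A → C) ⇔ (B → D)
→-⇔ e f = mk⇔ (λ g → to f ∘ g ∘ from e) (λ g → from f ∘ g ∘ to e)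

∀-⇔ : {A : Set ℓ} {B C : A → Set ℓ} → (∀ x → B x ⇔ C x) → (∀ x → B x) ⇔ (∀ x → C x)
∀-⇔ e = mk⇔ (λ f x → to (e x) (f x)) (λ f x → from (e x) (f x))

∃-⇔ : {A : Set ℓ} {B C : A → Set ℓ} → (∀ x → B x ⇔ C x) → ∃ B ⇔ ∃ C
∃-⇔ e = mk⇔ (λ (x , b) → x , to (e x) b) (λ (x , c) → x , from (e x) c)

rename : (Fin n → Fin m) → Formula n → Formula m
rename r (i ∈′ j) = r i ∈′ r j
rename r (i ≈′ j) = r i ≈′ r j
rename r ⊥′       = ⊥′
rename r (φ ⇒′ ψ) = rename r φ ⇒′ rename r ψ
rename r (φ ∧′ ψ) = rename r φ ∧′ rename r ψ
rename r (φ ∨′ ψ) = rename r φ ∨′ rename r ψ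
rename r (∀′ φ)   = ∀′ rename (lift 1 r) φ
rename r (∃′ φ)   = ∃′ rename (lift 1 r) φ

lookup-lift : {A : Set ℓ} (xs : Vec A n) (ps : Vec A m) (qs : Vec A k) (r : Fin m → Fin k) →
              (∀ j → lookup ps j ≡ lookup qs (r j)) →
              ∀ i → lookup (xs ++ ps) i ≡ lookup (xs ++ qs) (lift n r i)
lookup-lift []       ps qs r eq i       = eq i
lookup-lift (x ∷ xs) ps qs r eq zero    = refl
lookup-lift (x ∷ xs) ps qs r eq (suc i) = lookup-lift xs ps qs r eq i

-- Predicates definable by formulas with parameters

module Definability (S : Structure ℓ) where

  open Structure S public
  open SetTheory S public
  module ≈ = IsEquivalence isEquivalence

  -- Environments are compared up to `≈`, so the same lemma yields reindexing of parameters and,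
  -- with the identity renaming, invariance under `≈`.
  ⊨-rename : (φ : Formula n) (r : Fin n → Fin m) {ρ : Vec U n} {σ : Vec U m} →
             (∀ i → lookup ρ i ≈ lookup σ (r i)) → (ρ ⊨ φ) ⇔ (σ ⊨ rename r φ)
  ⊨-rename-∷ : (φ : Formula (suc n)) (r : Fin n → Fin m) {ρ : Vec U n} {σ : Vec U m} →
               (∀ i → lookup ρ i ≈ lookup σ (r i)) →
               ∀ x → (x ∷ ρ ⊨ φ) ⇔ (x ∷ σ ⊨ rename (lift 1 r) φ)
  ⊨-rename (i ∈′ j) r eq = mk⇔
    (proj₁ ∈-resp-≈ (eq j) ∘ proj₂ ∈-resp-≈ (eq i))
    (proj₁ ∈-resp-≈ (≈.sym (eq j)) ∘ proj₂ ∈-resp-≈ (≈.sym (eq i)))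
  ⊨-rename (i ≈′ j) r eq = mk⇔
    (λ e → ≈.trans (≈.sym (eq i)) (≈.trans e (eq j)))
    (λ e → ≈.trans (eq i) (≈.trans e (≈.sym (eq j))))
  ⊨-rename ⊥′       r eq = mk⇔ id id
  ⊨-rename (φ ⇒′ ψ) r eq = →-⇔ (⊨-rename φ r eq) (⊨-rename ψ r eq)
  ⊨-rename (φ ∧′ ψ) r eq = ⊨-rename φ r eq ×-⇔ ⊨-rename ψ r eq
  ⊨-rename (φ ∨′ ψ) r eq = ⊨-rename φ r eq ⊎-⇔ ⊨-rename ψ r eq
  ⊨-rename (∀′ φ)   r eq = ∀-⇔ (⊨-rename-∷ φ r eq)
  ⊨-rename (∃′ φ)   r eq = ∃-⇔ (⊨-rename-∷ φ r eq)
  ⊨-rename-∷ φ r eq x =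
    ⊨-rename φ (lift 1 r) λ { zero → ≈.refl ; (suc i) → eq i }

  -- Environments are nested pairs rather than vectors so that η lets the
  -- unifier recover a predicate from its values on variables.

  Env : ℕ → Set ℓ
  Env zero    = ⊤
  Env (suc n) = U × Env n

  vec : Env n → Vec U n
  vec {n = zero}  _       = []
  vec {n = suc n} (x , ρ) = x ∷ vec ρ

  infix 4 _≈ᵉ_
  _≈ᵉ_ : Env n → Env n → Set ℓ
  _≈ᵉ_ {n = zero}  _       _       = ⊤
  _≈ᵉ_ {n = suc n} (x , ρ) (y , σ) = x ≈ y × ρ ≈ᵉ σ

  record Def {n} (Q : Env n → Set ℓ) : Set ℓ where
    field
      {size}     : ℕ
      parameters : Vec U size
      formula    : Formula (n + size)
      spec       : ∀ ρ → Q ρ ⇔ (vec ρ ++ parameters ⊨ formula)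

  -- The language has no function symbols, so a term is a variable or a parameter.
  record Term {n} (f : Env n → U) : Set ℓ where
    field
      {size}     : ℕ
      parameters : Vec U size
      index      : Fin (n + size)
      spec       : ∀ ρ → lookup (vec ρ ++ parameters) index ≡ f ρ

  Def₁ : (U → Set ℓ) → Set ℓ
  Def₁ Q = Def {1} (λ ρ → Q (proj₁ ρ))

  Def₂ : (U → U → Set ℓ) → Set ℓ
  Def₂ Q = Def {2} (λ ρ → Q (proj₁ ρ) (proj₁ (proj₂ ρ)))

  -- Asking for all contexts and all terms builds in closure under substitution, and no substitution
  -- on formulas has to be defined.
  Definable₂ : (U → U → Set ℓ) → Set ℓ
  Definable₂ Q = ∀ {n} {f g : Env n → U} → Term f → Term g → Def (λ ρ → Q (f ρ) (g ρ))

  Definable₃ : (U → U → U → Set ℓ) → Set ℓ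
  Definable₃ Q = ∀ {n} {f g h : Env n → U} → Term f → Term g → Term h →
                 Def (λ ρ → Q (f ρ) (g ρ) (h ρ))

  -- Two definitions are combined over the concatenation of their parameter lists; each side is
  -- reindexed to find its own half.
  lookup-widenˡ : (xs : Vec U n) (ps : Vec U m) (qs : Vec U k) → ∀ i →
                  lookup (xs ++ ps) i ≡ lookup (xs ++ (ps ++ qs)) (lift n (_↑ˡ k) i)
  lookup-widenˡ xs ps qs =
    lookup-lift xs ps (ps ++ qs) _ (λ j → sym (lookup-++ˡ ps qs j))

  lookup-widenʳ : (xs : Vec U n) (ps : Vec U m) (qs : Vec U k) → ∀ i →
                  lookup (xs ++ qs) i ≡ lookup (xs ++ (ps ++ qs)) (lift n (m ↑ʳ_) i)
  lookup-widenʳ xs ps qs =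
    lookup-lift xs qs (ps ++ qs) _ (λ j → sym (lookup-++ʳ ps qs j))

  abstract

    module _ {f g : Env n → U} where

      atom : {R : U → U → Set ℓ} (_R′_ : ∀ {m} → Fin m → Fin m → Formula m) →
             (∀ {m} (ρ : Vec U m) i j → R (lookup ρ i) (lookup ρ j) ⇔ (ρ ⊨ i R′ j)) →
             Term f → Term g → Def (λ ρ → R (f ρ) (g ρ))
      atom {R} _R′_ eq s t = record
        { parameters = s.parameters ++ t.parameters
        ; formula    = lift n (_↑ˡ t.size) s.index R′ lift n (s.size ↑ʳ_) t.index
        ; spec       = λ ρ → subst₂ (λ a b → R a b ⇔ _)
            (trans (sym (lookup-widenˡ (vec ρ) s.parameters t.parameters s.index)) (s.spec ρ))
            (trans (sym (lookup-widenʳ (vec ρ) s.parameters t.parameters t.index)) (t.spec ρ))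
            (eq _ _ _) }
        where
        module s = Term s
        module t = Term t

      infix 6 _∈ᵈ_ _≈ᵈ_
      _∈ᵈ_ : Term f → Term g → Def (λ ρ → f ρ ∈ g ρ)
      _∈ᵈ_ = atom {_∈_} _∈′_ λ _ _ _ → mk⇔ id id

      _≈ᵈ_ : Term f → Term g → Def (λ ρ → f ρ ≈ g ρ)
      _≈ᵈ_ = atom {_≈_} _≈′_ λ _ _ _ → mk⇔ id id

    module _ {Q R : Env n → Set ℓ} where

      connective : {_∙_ : Set ℓ → Set ℓ → Set ℓ} (_∙′_ : ∀ {m} → Formula m → Formula m → Formula m) →
                   (∀ {A B m} (ρ : Vec U m) φ ψ → A ⇔ (ρ ⊨ φ) → B ⇔ (ρ ⊨ ψ) → (A ∙ B) ⇔ (ρ ⊨ φ ∙′ ψ)) →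
                   Def Q → Def R → Def (λ ρ → Q ρ ∙ R ρ)
      connective _∙′_ eq s t = record
        { parameters = s.parameters ++ t.parameters
        ; formula    = rename (lift n (_↑ˡ t.size)) s.formula ∙′ rename (lift n (s.size ↑ʳ_)) t.formula
        ; spec       = λ ρ → eq _ _ _
            (⊨-rename s.formula _ (≈.reflexive ∘ lookup-widenˡ (vec ρ) s.parameters t.parameters) ⇔-∘ s.spec ρ)
            (⊨-rename t.formula _ (≈.reflexive ∘ lookup-widenʳ (vec ρ) s.parameters t.parameters) ⇔-∘ t.spec ρ) }
        where
        module s = Def s
        module t = Def t

      infixr 5 _×ᵈ_
      _×ᵈ_ : Def Q → Def R → Def (λ ρ → Q ρ × R ρ)
      _×ᵈ_ = connective _∧′_ λ _ _ _ → _×-⇔_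

      infixr 4 _⊎ᵈ_
      _⊎ᵈ_ : Def Q → Def R → Def (λ ρ → Q ρ ⊎ R ρ)
      _⊎ᵈ_ = connective _∨′_ λ _ _ _ → _⊎-⇔_

      infixr 3 _→ᵈ_
      _→ᵈ_ : Def Q → Def R → Def (λ ρ → Q ρ → R ρ)
      _→ᵈ_ = connective _⇒′_ λ _ _ _ → →-⇔

    infix 3 _⇔ᵈ_
    _⇔ᵈ_ : {Q R : Env n → Set ℓ} → Def Q → Def R → Def (λ ρ → Q ρ ⇔ R ρ)
    s ⇔ᵈ t = record
      { parameters = b.parameters
      ; formula    = b.formula
      ; spec       = λ ρ → b.spec ρ ⇔-∘ mk⇔ (λ e → to e , from e) (λ (f , g) → mk⇔ f g) }
      where module b = Def ((s →ᵈ t) ×ᵈ (t →ᵈ s))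

    infix 6 ¬ᵈ_
    ¬ᵈ_ : {Q : Env n → Set ℓ} → Def Q → Def (λ ρ → ¬ Q ρ)
    ¬ᵈ s = record
      { parameters = s.parameters
      ; formula    = s.formula ⇒′ ⊥′
      ; spec       = λ ρ → mk⇔ (λ ¬q x → ⊥-elim (¬q (from (s.spec ρ) x)))
                               (λ f q → Level.Lift.lower (f (to (s.spec ρ) q))) }
      where module s = Def s

    module _ {Q : U → Env n → Set ℓ} where

      infixr 3 ∀ᵈ_ ∃ᵈ_
      ∀ᵈ_ : Def {suc n} (λ ρ → Q (proj₁ ρ) (proj₂ ρ)) → Def (λ ρ → ∀ x → Q x ρ)
      ∀ᵈ s = record { parameters = s.parameters ; formula = ∀′ s.formula
                    ; spec = λ ρ → ∀-⇔ λ x → s.spec (x , ρ) }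
        where module s = Def s

      ∃ᵈ_ : Def {suc n} (λ ρ → Q (proj₁ ρ) (proj₂ ρ)) → Def (λ ρ → ∃[ x ] Q x ρ)
      ∃ᵈ s = record { parameters = s.parameters ; formula = ∃′ s.formula
                    ; spec = λ ρ → ∃-⇔ λ x → s.spec (x , ρ) }
        where module s = Def s

  con : (c : U) → Term {n} (λ _ → c)
  con {n} c = record { parameters = c ∷ [] ; index = n ↑ʳ zero
                     ; spec = λ ρ → lookup-++ʳ (vec ρ) (c ∷ []) zero }

  wk : {f : Env n → U} → Term f → Term {suc n} (λ ρ → f (proj₂ ρ))
  wk t = record { parameters = t.parameters ; index = suc t.index ; spec = λ ρ → t.spec (proj₂ ρ) }
    where module t = Term t

  v0 : Term {suc n} proj₁
  v0 = record { parameters = [] ; index = zero ; spec = λ _ → refl }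

  v1 : Term {suc (suc n)} (λ ρ → proj₁ (proj₂ ρ))
  v1 = wk v0

  v2 : Term {suc (suc (suc n))} (λ ρ → proj₁ (proj₂ (proj₂ ρ)))
  v2 = wk v1

  v3 : Term {suc (suc (suc (suc n)))} (λ ρ → proj₁ (proj₂ (proj₂ (proj₂ ρ))))
  v3 = wk v2

  lookup-vec : {ρ σ : Env n} (ps : Vec U m) → ρ ≈ᵉ σ →
               ∀ i → lookup (vec ρ ++ ps) i ≈ lookup (vec σ ++ ps) i
  lookup-vec {n = zero}  ps _         i       = ≈.refl
  lookup-vec {n = suc n} ps (e , eq) zero    = e
  lookup-vec {n = suc n} ps (e , eq) (suc i) = lookup-vec ps eq i

  -- Invariance under the congruence comes for free from a defining formula. `⊨-rename` is applied
  -- twice because `rename id` is not definitionally the identity.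
  resp : {Q : Env n → Set ℓ} → Def Q → {ρ σ : Env n} → ρ ≈ᵉ σ → Q ρ → Q σ
  resp s {ρ} {σ} eq q = from (s.spec σ)
    (from (⊨-rename s.formula id {σ = vec σ ++ s.parameters} (λ _ → ≈.refl))
      (to (⊨-rename s.formula id (lookup-vec s.parameters eq)) (to (s.spec ρ) q)))
    where module s = Def s

  opaque
    IsPairᵈ : {f g h : Env n → U} → Term f → Term g → Term h → Def (λ ρ → IsPair (f ρ) (g ρ) (h ρ))
    IsPairᵈ a b c = ∀ᵈ (v0 ∈ᵈ wk a ⇔ᵈ v0 ≈ᵈ wk b ⊎ᵈ v0 ≈ᵈ wk c)

  opaque
    IsOrderedPairᵈ : {f g h : Env n → U} → Term f → Term g → Term h →
                     Def (λ ρ → IsOrderedPair (f ρ) (g ρ) (h ρ))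
    IsOrderedPairᵈ a b c = ∃ᵈ ∃ᵈ (IsPairᵈ v1 (wk (wk b)) (wk (wk b))
        ×ᵈ IsPairᵈ v0 (wk (wk b)) (wk (wk c)) ×ᵈ IsPairᵈ (wk (wk a)) v1 v0)

  opaque
    ⟨_,_⟩∈ᵈ_ : {f g h : Env n → U} → Term f → Term g → Term h → Def (λ ρ → ⟨ f ρ , g ρ ⟩∈ h ρ)
    ⟨ a , b ⟩∈ᵈ c = ∃ᵈ (IsOrderedPairᵈ v0 (wk a) (wk b) ×ᵈ v0 ∈ᵈ wk c)

  opaque
    IsEmptyᵈ : {f : Env n → U} → Term f → Def (λ ρ → IsEmpty (f ρ))
    IsEmptyᵈ a = ∀ᵈ ¬ᵈ (v0 ∈ᵈ wk a)

  opaque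
    IsSuccessorᵈ : {f g : Env n → U} → Term f → Term g → Def (λ ρ → IsSuccessor (f ρ) (g ρ))
    IsSuccessorᵈ a b = ∀ᵈ (v0 ∈ᵈ wk a ⇔ᵈ v0 ∈ᵈ wk b ⊎ᵈ v0 ≈ᵈ wk b)

  opaque
    IsInductiveᵈ : {f : Env n → U} → Term f → Def (λ ρ → IsInductive (f ρ))
    IsInductiveᵈ a = (∃ᵈ (IsEmptyᵈ v0 ×ᵈ v0 ∈ᵈ wk a))
      ×ᵈ (∀ᵈ (v0 ∈ᵈ wk a →ᵈ ∃ᵈ (IsSuccessorᵈ v0 v1 ×ᵈ v0 ∈ᵈ wk (wk a))))

-- Pairs, products and successors in a model of ZF

module ZF (S : Structure ℓ) (zf : SetTheory.IsZF S) where

  open Definability S public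
  open IsZF zf public

  ∈-respˡ : ∀ {a b x} → a ≈ b → a ∈ x → b ∈ x
  ∈-respˡ = proj₂ ∈-resp-≈

  ∈-respʳ : ∀ {a x y} → x ≈ y → a ∈ x → a ∈ y
  ∈-respʳ = proj₁ ∈-resp-≈

  opaque
    separate : {Q : U → Set ℓ} → Def₁ Q → ∀ x → ∃[ y ] (∀ z → z ∈ y ⇔ (z ∈ x × Q z))
    separate d x with separation (Def.formula d) (Def.parameters d) x
    ... | y , e = y , λ z → (mk⇔ id id ×-⇔ ⇔-sym (Def.spec d (z , tt))) ⇔-∘ e z

  opaque
    replace : {Q : U → U → Set ℓ} → Def₂ Q → ∀ x →
              (∀ a b b′ → a ∈ x → Q a b → Q a b′ → b ≈ b′) →
              ∃[ y ] (∀ b → b ∈ y ⇔ (∃[ a ] (a ∈ x × Q a b)))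
    replace d x fun with replacement (Def.formula d) (Def.parameters d) x
                           (λ a b b′ a∈x q q′ → fun a b b′ a∈x (from (Def.spec d (a , b , tt)) q)
                                                               (from (Def.spec d (a , b′ , tt)) q′))
    ... | y , e = y , λ b → ∃-⇔ (λ a → mk⇔ id id ×-⇔ ⇔-sym (Def.spec d (a , b , tt))) ⇔-∘ e b

  isOrderedPair-resp : ∀ {z z′ a a′ b b′} → z ≈ z′ → a ≈ a′ → b ≈ b′ →
                       IsOrderedPair z a b → IsOrderedPair z′ a′ b′
  isOrderedPair-resp p q r = resp (IsOrderedPairᵈ v0 v1 v2) (p , q , r , tt)

  ⟨⟩∈-resp : ∀ {a a′ b b′ r} → a ≈ a′ → b ≈ b′ → ⟨ a , b ⟩∈ r → ⟨ a′ , b′ ⟩∈ r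
  ⟨⟩∈-resp {r = r} p q = resp (⟨ v0 , v1 ⟩∈ᵈ con r) (p , q , tt)

  isPair-left : ∀ {z a b} → IsPair z a b → a ∈ z
  isPair-left p = from (p _) (inj₁ ≈.refl)

  isPair-right : ∀ {z a b} → IsPair z a b → b ∈ z
  isPair-right p = from (p _) (inj₂ ≈.refl)

  isPair-unique : ∀ {z z′ a b} → IsPair z a b → IsPair z′ a b → z ≈ z′
  isPair-unique p p′ = extensionality _ _ λ w → ⇔-sym (p′ w) ⇔-∘ p w

  opaque
    orderedPair : ∀ a b → ∃[ z ] IsOrderedPair z a b
    orderedPair a b with pairing a a | pairing a b
    ... | s , ps | t , pt with pairing s t
    ... | z , pz = z , s , t , ps , pt , pz

  orderedPair-unique : ∀ {z z′ a b} → IsOrderedPair z a b → IsOrderedPair z′ a b → z ≈ z′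
  orderedPair-unique (s , t , ps , pt , pz) (s′ , t′ , ps′ , pt′ , pz′) =
    isPair-unique pz (resp (IsPairᵈ (con _) v0 v1)
      (isPair-unique ps′ ps , isPair-unique pt′ pt , tt) pz′)

  -- The set {a} equals {a′} or {a′,b′}, and a′ belongs to both.
  orderedPair-injectiveˡ : ∀ {z a b a′ b′} → IsOrderedPair z a b → IsOrderedPair z a′ b′ → a ≈ a′
  orderedPair-injectiveˡ (s , t , ps , pt , pz) (s′ , t′ , ps′ , pt′ , pz′)
    with to (pz′ s) (isPair-left pz)
  ... | inj₁ e = ≈.sym ([ id , id ]′ (to (ps _) (∈-respʳ (≈.sym e) (isPair-left ps′))))
  ... | inj₂ e = ≈.sym ([ id , id ]′ (to (ps _) (∈-respʳ (≈.sym e) (isPair-left pt′))))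

  -- As {a,b} equals {a′} or {a′,b′}, b is a′ or b′; symmetrically b′ is a or b. The one crossed
  -- case, b = a′ and b′ = a, closes by equality of the first components.
  orderedPair-injectiveʳ : ∀ {z a b a′ b′} → IsOrderedPair z a b → IsOrderedPair z a′ b′ → b ≈ b′
  orderedPair-injectiveʳ {z} p p′ with orderedPair-injectiveˡ p p′ | half p p′ | half p′ p
    where
    half : ∀ {a b a′ b′} → IsOrderedPair z a b → IsOrderedPair z a′ b′ → b ≈ a′ ⊎ b ≈ b′
    half (s , t , ps , pt , pz) (s′ , t′ , ps′ , pt′ , pz′) with to (pz′ t) (isPair-right pz)
    ... | inj₁ e = inj₁ ([ id , id ]′ (to (ps′ _) (∈-respʳ e (isPair-right pt))))
    ... | inj₂ e = to (pt′ _) (∈-respʳ e (isPair-right pt))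
  ... | _ | inj₂ e | _      = e
  ... | _ | inj₁ _ | inj₂ e = ≈.sym e
  ... | a≈a′ | inj₁ e | inj₁ e′ = ≈.trans e (≈.trans (≈.sym a≈a′) (≈.sym e′))

  ⟨⟩∈-elim : ∀ {z a b r} → IsOrderedPair z a b → ⟨ a , b ⟩∈ r → z ∈ r
  ⟨⟩∈-elim op (z′ , op′ , z′∈r) = ∈-respˡ (orderedPair-unique op′ op) z′∈r

  opaque
    binaryUnion : ∀ a b → ∃[ c ] (∀ z → z ∈ c ⇔ (z ∈ a ⊎ z ∈ b))
    binaryUnion a b with pairing a b
    ... | p , ip with union p
    ... | c , ic = c , λ z → mk⇔
      (λ z∈c → let (w , w∈p , z∈w) = to (ic z) z∈c in
               [ (λ e → inj₁ (∈-respʳ e z∈w)) , (λ e → inj₂ (∈-respʳ e z∈w)) ]′ (to (ip w) w∈p))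
      [ (λ z∈a → from (ic z) (a , isPair-left ip , z∈a))
      , (λ z∈b → from (ic z) (b , isPair-right ip , z∈b)) ]′

  opaque
    -- Kuratowski pairs from `a` and `b` lie in the double power set of their union.
    product : ∀ a b → ∃[ c ] (∀ z → z ∈ c ⇔ (∃[ x ] ∃[ y ] (x ∈ a × y ∈ b × IsOrderedPair z x y)))
    product a b =
      let (u , iu) = binaryUnion a b
          (q , iq) = powerset u
          (r , ir) = powerset q
          (c , ic) = separate (∃ᵈ ∃ᵈ (v1 ∈ᵈ con a ×ᵈ v0 ∈ᵈ con b ×ᵈ IsOrderedPairᵈ v2 v1 v0)) r
          pair∈q : ∀ {x y s} → x ∈ u → y ∈ u → IsPair s x y → s ∈ q
          pair∈q x∈u y∈u p = from (iq _) λ w w∈s →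
            [ (λ e → ∈-respˡ (≈.sym e) x∈u) , (λ e → ∈-respˡ (≈.sym e) y∈u) ]′ (to (p w) w∈s)
      in c , λ z → mk⇔ (proj₂ ∘ to (ic z))
        λ (x , y , x∈a , y∈b , s , t , ps , pt , pz) →
          let x∈u = from (iu x) (inj₁ x∈a)
              y∈u = from (iu y) (inj₂ y∈b)
          in from (ic z) (from (ir z) (λ w w∈z →
               [ (λ e → ∈-respˡ (≈.sym e) (pair∈q x∈u x∈u ps))
               , (λ e → ∈-respˡ (≈.sym e) (pair∈q x∈u y∈u pt)) ]′ (to (pz w) w∈z))
               , x , y , x∈a , y∈b , s , t , ps , pt , pz)

  ∈-asymmetric : ∀ {x y} → x ∈ y → ¬ (y ∈ x)
  ∈-asymmetric {x} {y} x∈y y∈x with pairing x y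
  ... | p , ip with foundation p (x , isPair-left ip)
  ... | z , z∈p , min with to (ip z) z∈p
  ... | inj₁ e = min y (isPair-right ip) (∈-respʳ (≈.sym e) y∈x)
  ... | inj₂ e = min x (isPair-left ip) (∈-respʳ (≈.sym e) x∈y)

  isSuccessor-injective : ∀ {x y s} → IsSuccessor s x → IsSuccessor s y → x ≈ y
  isSuccessor-injective {x} {y} p q
    with to (q x) (from (p x) (inj₂ ≈.refl)) | to (p y) (from (q y) (inj₂ ≈.refl))
  ... | inj₂ e   | _        = e
  ... | inj₁ _   | inj₂ e   = ≈.sym e
  ... | inj₁ x∈y | inj₁ y∈x = ⊥-elim (∈-asymmetric x∈y y∈x)

  isSuccessor-unique : ∀ {x s t} → IsSuccessor s x → IsSuccessor t x → s ≈ t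
  isSuccessor-unique p q = extensionality _ _ λ w → ⇔-sym (q w) ⇔-∘ p w

  isEmpty-unique : ∀ {e e′} → IsEmpty e → IsEmpty e′ → e ≈ e′
  isEmpty-unique p q = extensionality _ _ λ w → mk⇔ (⊥-elim ∘ p w) (⊥-elim ∘ q w)

  -- The set of natural numbers

  opaque
    omega : ∃ IsOmega
    omega with infinity
    ... | i , ((e , e-empty , e∈i) , closed) with separate (∀ᵈ (IsInductiveᵈ v0 →ᵈ v1 ∈ᵈ v0)) i
    ... | ω , iω = ω ,
      ( ( (e , e-empty , from (iω e) (e∈i , λ j ((e′ , e′-empty , e′∈j) , _) →
                                        ∈-respˡ (isEmpty-unique e′-empty e-empty) e′∈j))
        , λ y y∈ω → let (y∈i , y∈all) = to (iω y) y∈ω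
                        (s , is , s∈i) = closed y y∈i in
                    s , is , from (iω s) (s∈i , λ j ij →
                      let (s′ , is′ , s′∈j) = proj₂ ij y (y∈all j ij) in
                      ∈-respˡ (isSuccessor-unique is′ is) s′∈j))
      , λ j ij z z∈ω → proj₂ (to (iω z) z∈ω) j ij)

  module _ {ω : U} (isω : IsOmega ω) where

    ω-induction : {Q : U → Set ℓ} → Def₁ Q → (∀ e → IsEmpty e → Q e) →
                  (∀ n s → n ∈ ω → IsSuccessor s n → Q n → Q s) → ∀ n → n ∈ ω → Q n
    ω-induction d base step n n∈ω with separate d ω | proj₁ isω
    ... | y , iy | (e , e-empty , e∈ω) , closed =
      proj₂ (to (iy n) (proj₂ isω y
        ( (e , e-empty , from (iy e) (e∈ω , base e e-empty))
        , λ m m∈y → let (m∈ω , qm) = to (iy m) m∈y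
                        (s , is , s∈ω) = closed m m∈ω in
                    s , is , from (iy s) (s∈ω , step m s m∈ω is qm)) n n∈ω))

    ω-empty : ∀ e → IsEmpty e → ∀ n → n ∈ ω → e ∈ n ⊎ e ≈ n
    ω-empty e e-empty = ω-induction (con e ∈ᵈ v0 ⊎ᵈ con e ≈ᵈ v0)
      (λ e′ e′-empty → inj₂ (isEmpty-unique e-empty e′-empty))
      (λ n s _ is ih → inj₁ (from (is e) ih))

    ω-successor : ∀ m s → IsSuccessor s m → ∀ n → n ∈ ω → m ∈ n → s ∈ n ⊎ s ≈ n
    ω-successor m s is = ω-induction (con m ∈ᵈ v0 →ᵈ con s ∈ᵈ v0 ⊎ᵈ con s ≈ᵈ v0)
      (λ e e-empty m∈e → ⊥-elim (e-empty m m∈e))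
      (λ n t _ it ih m∈t → [ (λ m∈n → inj₁ (from (it s) (ih m∈n)))
                           , (λ m≈n → inj₂ (isSuccessor-unique is
                               (resp (IsSuccessorᵈ (con t) v0) (≈.sym m≈n , tt) it))) ]′ (to (it m) m∈t))

    -- Comparability is what makes least indices unique. The induction is on `m`; its two cases are
    -- the preceding lemmas, themselves inductions on `n`.
    ω-trichotomy : ∀ m → m ∈ ω → ∀ n → n ∈ ω → m ∈ n ⊎ m ≈ n ⊎ n ∈ m
    ω-trichotomy = ω-induction (∀ᵈ (v0 ∈ᵈ con ω →ᵈ v1 ∈ᵈ v0 ⊎ᵈ v1 ≈ᵈ v0 ⊎ᵈ v0 ∈ᵈ v1))
      (λ e e-empty n n∈ω → [ inj₁ , inj₂ ∘ inj₁ ]′ (ω-empty e e-empty n n∈ω))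
      (λ m s _ is ih n n∈ω →
        [ (λ m∈n → [ inj₁ , inj₂ ∘ inj₁ ]′ (ω-successor m s is n n∈ω m∈n))
        , [ (λ m≈n → inj₂ (inj₂ (from (is n) (inj₂ (≈.sym m≈n)))))
          , (λ n∈m → inj₂ (inj₂ (from (is n) (inj₁ n∈m)))) ]′ ]′ (ih n n∈ω))

  -- Transitive closures

  IsTransitive : U → Set ℓ
  IsTransitive s = ∀ x y → x ∈ s → y ∈ x → y ∈ s

  IsUnion : U → U → Set ℓ
  IsUnion y x = ∀ z → z ∈ y ⇔ (∃[ w ] (w ∈ x × z ∈ w))

  IsUnionᵈ : {f g : Env n → U} → Term f → Term g → Def (λ ρ → IsUnion (f ρ) (g ρ))
  IsUnionᵈ a b = ∀ᵈ (v0 ∈ᵈ wk a ⇔ᵈ (∃ᵈ (v0 ∈ᵈ wk (wk b) ×ᵈ v1 ∈ᵈ v0)))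

  isUnion-unique : ∀ {x y y′} → IsUnion y x → IsUnion y′ x → y ≈ y′
  isUnion-unique p q = extensionality _ _ λ w → ⇔-sym (q w) ⇔-∘ p w

  module TransitiveClosure (x : U) where

    -- F is a set of pairs ⟨n,s⟩, each of which is a consequence of the recursion
    -- ⋃⁰x = x, ⋃ⁿ⁺¹x = ⋃⋃ⁿx and of another pair in F.
    Justified : U → U → U → Set ℓ
    Justified F n s = (IsEmpty n × s ≈ x)
      ⊎ ∃[ m ] ∃[ t ] (⟨ m , t ⟩∈ F × IsSuccessor n m × IsUnion s t)

    IsAttempt : U → Set ℓ
    IsAttempt F = ∀ n s → ⟨ n , s ⟩∈ F → Justified F n s

    IsIterate : U → U → Set ℓ
    IsIterate n s = ∃[ F ] (IsAttempt F × ⟨ n , s ⟩∈ F)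

    Justifiedᵈ : {f g h : Env n → U} → Term f → Term g → Term h →
                 Def (λ ρ → Justified (f ρ) (g ρ) (h ρ))
    Justifiedᵈ a b c = IsEmptyᵈ b ×ᵈ c ≈ᵈ con x
      ⊎ᵈ (∃ᵈ ∃ᵈ ((⟨ v1 , v0 ⟩∈ᵈ wk (wk a)) ×ᵈ IsSuccessorᵈ (wk (wk b)) v1 ×ᵈ IsUnionᵈ (wk (wk c)) v0))

    IsIterateᵈ : {f g : Env n → U} → Term f → Term g → Def (λ ρ → IsIterate (f ρ) (g ρ))
    IsIterateᵈ a b = ∃ᵈ ((∀ᵈ ∀ᵈ (⟨ v1 , v0 ⟩∈ᵈ v2 →ᵈ Justifiedᵈ v2 v1 v0)) ×ᵈ (⟨ wk a , wk b ⟩∈ᵈ v0))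

    -- Justification is monotone in `F`, so adding one justified pair spoils none of the old ones.
    extend : ∀ F n s → IsAttempt F → Justified F n s → IsIterate n s
    extend F n s att just with orderedPair n s
    ... | z , oz with pairing z z
    ... | z₁ , iz₁ with binaryUnion F z₁
    ... | F′ , iF′ = F′ , att′ , z , oz , from (iF′ z) (inj₂ (isPair-left iz₁))
      where
      mono : ∀ {m t} → Justified F m t → Justified F′ m t
      mono (inj₁ c) = inj₁ c
      mono (inj₂ (m , t , (w , ow , w∈F) , c)) = inj₂ (m , t , (w , ow , from (iF′ w) (inj₁ w∈F)) , c)
      att′ : IsAttempt F′
      att′ m t (w , ow , w∈F′) with to (iF′ w) w∈F′
      ... | inj₁ w∈F  = mono (att m t (w , ow , w∈F))
      ... | inj₂ w∈z₁ = resp (Justifiedᵈ (con F′) v0 v1)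
        ( ≈.sym (orderedPair-injectiveˡ ow′ oz) , ≈.sym (orderedPair-injectiveʳ ow′ oz) , tt) (mono just)
        where ow′ = isOrderedPair-resp ([ id , id ]′ (to (iz₁ w) w∈z₁)) ≈.refl ≈.refl ow

    isIterate-empty : ∀ e → IsEmpty e → IsIterate e x
    isIterate-empty e e-empty with separate (¬ᵈ (v0 ≈ᵈ v0)) x
    ... | F , iF = extend F e x (λ _ _ (z , _ , z∈F) → ⊥-elim (proj₂ (to (iF z) z∈F) ≈.refl))
                     (inj₁ (e-empty , ≈.refl))

    isIterate-successor : ∀ n m s t → IsSuccessor m n → IsUnion t s → IsIterate n s → IsIterate m t
    isIterate-successor n m s t is iu (F , att , w) = extend F m t att (inj₂ (n , s , w , is , iu))

    module _ {ω : U} (isω : IsOmega ω) where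

      isIterate-unique : ∀ n → n ∈ ω → ∀ s s′ → IsIterate n s → IsIterate n s′ → s ≈ s′
      isIterate-unique = ω-induction isω (∀ᵈ ∀ᵈ (IsIterateᵈ v2 v1 →ᵈ IsIterateᵈ v2 v0 →ᵈ v1 ≈ᵈ v0))
        (λ e e-empty s s′ it it′ → ≈.trans (base e e-empty s it) (≈.sym (base e e-empty s′ it′)))
        (λ n m _ is ih s s′ it it′ → let
          (t , itₜ , u) = step n m s is it
          (t′ , itₜ′ , u′) = step n m s′ is it′ in
          isUnion-unique u (resp (IsUnionᵈ (con s′) v0) (≈.sym (ih t t′ itₜ itₜ′) , tt) u′))
        where
        base : ∀ e → IsEmpty e → ∀ s → IsIterate e s → s ≈ x
        base e e-empty s (F , att , w) with att e s w
        ... | inj₁ (_ , eq) = eq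
        ... | inj₂ (m , _ , _ , is , _) = ⊥-elim (e-empty m (from (is m) (inj₂ ≈.refl)))
        step : ∀ n m s → IsSuccessor m n → IsIterate m s → ∃[ t ] (IsIterate n t × IsUnion s t)
        step n m s is (F , att , w) with att m s w
        ... | inj₁ (m-empty , _) = ⊥-elim (m-empty n (from (is n) (inj₂ ≈.refl)))
        ... | inj₂ (n′ , t , w′ , is′ , iu) =
          t , (F , att , ⟨⟩∈-resp (isSuccessor-injective is′ is) ≈.refl w′) , iu

  opaque
    -- The union of all iterates ⋃ⁿx: an element of an element of ⋃ⁿx lies in ⋃ⁿ⁺¹x.
    transitive-superset : ∀ x → ∃[ s ] (x ⊆ s × IsTransitive s)
    transitive-superset x =
      let open TransitiveClosure x
          (ω , isω) = omega
          (r , ir)  = replace (IsIterateᵈ v0 v1) ω (λ n s s′ n∈ω → isIterate-unique isω n n∈ω s s′)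
          (c , ic)  = union r
      in c
      , (λ z z∈x → let ((e , e-empty , e∈ω) , _) = proj₁ isω in
          from (ic z) (x , from (ir x) (e , e∈ω , isIterate-empty e e-empty) , z∈x))
      , λ y z y∈c z∈y → let
          (s , s∈r , y∈s) = to (ic y) y∈c
          (n , n∈ω , it) = to (ir s) s∈r
          (m , is , m∈ω) = proj₂ (proj₁ isω) n n∈ω
          (t , iu) = union s in
          from (ic z) (t , from (ir t) (m , m∈ω , isIterate-successor n m s t is iu it)
                         , from (iu z) (y , y∈s , z∈y))

  opaque
    transitive-∋ : ∀ x → ∃[ s ] (x ∈ s × IsTransitive s)
    transitive-∋ x with pairing x x
    ... | p , ip with transitive-superset p
    ... | s , p⊆s , tr = s , p⊆s x (isPair-left ip) , tr

  -- Graphs of definable functions and sets of triples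

  opaque
    graph : {Q : U → U → Set ℓ} → Definable₂ Q → ∀ x → (∀ a → a ∈ x → ∃[ b ] Q a b) →
            (∀ a b b′ → a ∈ x → Q a b → Q a b′ → b ≈ b′) →
            ∃[ f ] (IsFunctionOn f x × (∀ a b → ⟨ a , b ⟩∈ f → a ∈ x × Q a b))
    graph {Q} Qᵈ x exists unique = f , isFunctionOn , elim
      where
      image : ∃[ f ] (∀ k → k ∈ f ⇔ (∃[ a ] (a ∈ x × ∃[ b ] (IsOrderedPair k a b × Q a b))))
      image = replace (∃ᵈ (IsOrderedPairᵈ v2 v1 v0 ×ᵈ Qᵈ v1 v0)) x
        λ a k k′ a∈x (b , ok , q) (b′ , ok′ , q′) → orderedPair-unique
          (isOrderedPair-resp ≈.refl ≈.refl (unique a b b′ a∈x q q′) ok) ok′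
      f : U
      f = proj₁ image
      elim : ∀ a b → ⟨ a , b ⟩∈ f → a ∈ x × Q a b
      elim a b (k , ok , k∈f) with to (proj₂ image k) k∈f
      ... | a′ , a′∈x , b′ , ok′ , q = let a′≈a = orderedPair-injectiveˡ ok′ ok in
        ∈-respˡ a′≈a a′∈x , resp (Qᵈ v0 v1) (a′≈a , orderedPair-injectiveʳ ok′ ok , tt) q
      isFunctionOn : IsFunctionOn f x
      isFunctionOn = record
        { relation = λ k k∈f → let (a , a∈x , b , ok , _) = to (proj₂ image k) k∈f in a , b , a∈x , ok
        ; total    = λ a a∈x → let (b , q) = exists a a∈x ; (k , ok) = orderedPair a b in
                     b , k , ok , from (proj₂ image k) (a , a∈x , b , ok , q)
        ; unique   = λ a b b′ w w′ → unique a b b′ (proj₁ (elim a b w)) (proj₂ (elim a b w))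
                                                                       (proj₂ (elim a b′ w′)) }

  Triple : U → U → U → U → Set ℓ
  Triple e p σ z = ∃[ k ] (IsOrderedPair k σ z × ⟨ p , k ⟩∈ e)

  opaque
    Tripleᵈ : {e p σ z : Env n → U} → Term e → Term p → Term σ → Term z →
              Def (λ ρ → Triple (e ρ) (p ρ) (σ ρ) (z ρ))
    Tripleᵈ e p σ z = ∃ᵈ (IsOrderedPairᵈ v0 (wk σ) (wk z) ×ᵈ (⟨ wk p , v0 ⟩∈ᵈ wk e))

  triple-resp : ∀ {e p p′ σ σ′ z z′} → p ≈ p′ → σ ≈ σ′ → z ≈ z′ → Triple e p σ z → Triple e p′ σ′ z′
  triple-resp {e} a b c = resp (Tripleᵈ (con e) v0 v1 v2) (a , b , c , tt)

-- The forcing relation for σ = ž, inside V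

module Forcing (em : ExcludedMiddle ℓ) (V : Structure ℓ) (zf : SetTheory.IsZF V)
               (ℙ : ForcingNotion V) where

  open ZF V zf
  open ForcingNotion ℙ

  ≤-domˡ : ∀ {p q} → p ≤ q → p ∈ P
  ≤-domˡ (z , oz , z∈leq) with relation z z∈leq
  ... | p , q , p∈P , _ , oz′ = ∈-respˡ (orderedPair-injectiveˡ oz′ oz) p∈P

  infix 6 _≤ᵈ_
  _≤ᵈ_ : Definable₂ _≤_
  a ≤ᵈ b = ⟨ a , b ⟩∈ᵈ con leq

  -- With e read as "p′ ⊩ π = y̌ for ⟨p′,π,y⟩ ∈ e", these say that r visibly forces
  -- π ∈ ž, respectively y̌ ∈ σ.

  ForcesIn : U → U → U → U → Set ℓ
  ForcesIn e z π r = ∃[ y ] ∃[ p′ ] (y ∈ z × Triple e p′ π y × r ≤ p′)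

  ForcesHas : U → U → U → U → Set ℓ
  ForcesHas e σ y r = ∃[ π ] ∃[ q ] ∃[ p′ ] (⟨ π , q ⟩∈ σ × Triple e p′ π y × r ≤ q × r ≤ p′)

  -- The inclusions σ ⊆ ž and ž ⊆ σ, each required densely below `p`; an element ⟨π,q⟩ of σ counts
  -- only below `q`.
  Clause : U → U → U → U → Set ℓ
  Clause e p σ z =
      (∀ π q → ⟨ π , q ⟩∈ σ → ∀ r → r ≤ p → r ≤ q → ∃[ r′ ] (r′ ≤ r × ForcesIn e z π r′))
    × (∀ y → y ∈ z → ∀ r → r ≤ p → ∃[ r′ ] (r′ ≤ r × ForcesHas e σ y r′))

  -- The recursive definition of p ⊩ σ = ž, taken as a greatest fixed point: this
  -- avoids a recursion theorem, and well-foundedness makes the fixed point unique.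

  IsBisimulation : U → Set ℓ
  IsBisimulation e = ∀ p σ z → Triple e p σ z → Clause e p σ z

  ForcesEq : U → U → U → Set ℓ
  ForcesEq p σ z = ∃[ e ] (IsBisimulation e × Triple e p σ z)

  opaque
    ForcesInᵈ : {e z π r : Env n → U} → Term e → Term z → Term π → Term r →
                Def (λ ρ → ForcesIn (e ρ) (z ρ) (π ρ) (r ρ))
    ForcesInᵈ e z π r = ∃ᵈ ∃ᵈ (v1 ∈ᵈ wk (wk z) ×ᵈ Tripleᵈ (wk (wk e)) v0 (wk (wk π)) v1
                               ×ᵈ wk (wk r) ≤ᵈ v0)

    ForcesHasᵈ : {e σ y r : Env n → U} → Term e → Term σ → Term y → Term r →
                 Def (λ ρ → ForcesHas (e ρ) (σ ρ) (y ρ) (r ρ))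
    ForcesHasᵈ e σ y r = ∃ᵈ ∃ᵈ ∃ᵈ ((⟨ v2 , v1 ⟩∈ᵈ wk (wk (wk σ)))
      ×ᵈ Tripleᵈ (wk (wk (wk e))) v0 v2 (wk (wk (wk y)))
      ×ᵈ wk (wk (wk r)) ≤ᵈ v1 ×ᵈ wk (wk (wk r)) ≤ᵈ v0)

  opaque
    Clauseᵈ : {e p σ z : Env n → U} → Term e → Term p → Term σ → Term z →
              Def (λ ρ → Clause (e ρ) (p ρ) (σ ρ) (z ρ))
    Clauseᵈ e p σ z =
      (∀ᵈ ∀ᵈ (⟨ v1 , v0 ⟩∈ᵈ wk (wk σ) →ᵈ ∀ᵈ (v0 ≤ᵈ wk (wk (wk p)) →ᵈ v0 ≤ᵈ v1 →ᵈ
        ∃ᵈ (v0 ≤ᵈ v1 ×ᵈ ForcesInᵈ (wk (wk (wk (wk e)))) (wk (wk (wk (wk z)))) v3 v0))))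
      ×ᵈ (∀ᵈ (v0 ∈ᵈ wk z →ᵈ ∀ᵈ (v0 ≤ᵈ wk (wk p) →ᵈ
        ∃ᵈ (v0 ≤ᵈ v1 ×ᵈ ForcesHasᵈ (wk (wk (wk e))) (wk (wk (wk σ))) v2 v0))))

  opaque
    IsBisimulationᵈ : {e : Env n → U} → Term e → Def (λ ρ → IsBisimulation (e ρ))
    IsBisimulationᵈ e = ∀ᵈ ∀ᵈ ∀ᵈ (Tripleᵈ (wk (wk (wk e))) v2 v1 v0 →ᵈ Clauseᵈ (wk (wk (wk e))) v2 v1 v0)

  opaque
    ForcesEqᵈ : Definable₃ ForcesEq
    ForcesEqᵈ p σ z = ∃ᵈ (IsBisimulationᵈ v0 ×ᵈ Tripleᵈ v0 (wk p) (wk σ) (wk z))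

  -- The set `e` occurs only positively in `Clause`; hence a union of bisimulations is a
  -- bisimulation.
  clause-mono : ∀ {e e′ p σ z} → e ⊆ e′ → Clause e p σ z → Clause e′ p σ z
  clause-mono {e} {e′} e⊆e′ (l , r) =
      (λ π q πq r r≤p r≤q → let (r′ , r′≤r , y , p′ , y∈z , tr , r′≤p′) = l π q πq r r≤p r≤q in
        r′ , r′≤r , y , p′ , y∈z , mono tr , r′≤p′)
    , (λ y y∈z s s≤p → let (r′ , r′≤s , π , q , p′ , πq , tr , r′≤) = r y y∈z s s≤p in
        r′ , r′≤s , π , q , p′ , πq , mono tr , r′≤)
    where
    mono : ∀ {p σ z} → Triple e p σ z → Triple e′ p σ z
    mono (k , ok , w , ow , w∈e) = k , ok , w , ow , e⊆e′ w w∈e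

  opaque
    -- A Knaster-Tarski argument. The union `m` of all bisimulations inside `X` is one itself. The
    -- triples of `X` whose clause holds over `m` form a bisimulation `m⁺` containing `m`, so `m⁺` ⊆
    -- `m`, and the clause implies membership.
    maximal-bisimulation : ∀ t s → ∃[ e ] (IsBisimulation e ×
      (∀ p σ z → p ∈ P → σ ∈ t → z ∈ s → Clause e p σ z → Triple e p σ z))
    maximal-bisimulation t s =
      let (ts , its) = product t s
          (X , iX)   = product P ts
          (m , im)   = separate (∃ᵈ (IsBisimulationᵈ v0 ×ᵈ (∀ᵈ (v0 ∈ᵈ v1 →ᵈ v0 ∈ᵈ con X)) ×ᵈ v1 ∈ᵈ v0)) X

          ⊆-maximal : ∀ e → IsBisimulation e → e ⊆ X → e ⊆ m
          ⊆-maximal e bis e⊆X w w∈e = from (im w) (e⊆X w w∈e , e , bis , e⊆X , w∈e)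

          bis : IsBisimulation m
          bis p σ z (k , ok , w , ow , w∈m) =
            let (_ , e , bisₑ , e⊆X , w∈e) = to (im w) w∈m in
            clause-mono (⊆-maximal e bisₑ e⊆X) (bisₑ p σ z (k , ok , w , ow , w∈e))

          -- All decodings of an element as a triple are quantified over; by injectivity of pairs
          -- there is only one up to `≈`.
          (m⁺ , im⁺) = separate (∀ᵈ ∀ᵈ ∀ᵈ ∀ᵈ (IsOrderedPairᵈ v0 v2 v1 →ᵈ
                                   IsOrderedPairᵈ (wk v3) v3 v0 →ᵈ Clauseᵈ (con m) v3 v2 v1)) X

          m⊆m⁺ : m ⊆ m⁺
          m⊆m⁺ w w∈m = from (im⁺ w) (proj₁ (to (im w) w∈m) ,
            λ p σ z k ok ow → bis p σ z (k , ok , w , ow , w∈m))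

          bis⁺ : IsBisimulation m⁺
          bis⁺ p σ z (k , ok , w , ow , w∈m⁺) =
            clause-mono m⊆m⁺ (proj₂ (to (im⁺ w) w∈m⁺) p σ z k ok ow)
      in m , bis , λ p σ z p∈P σ∈t z∈s clause →
        let (k , ok) = orderedPair σ z
            (w , ow) = orderedPair p k
            w∈X = from (iX w) (p , k , p∈P , from (its k) (σ , z , σ∈t , z∈s , ok) , ow)
            w∈m⁺ = from (im⁺ w) (w∈X , λ p′ σ′ z′ k′ ok′ ow′ →
              let k≈k′ = orderedPair-injectiveʳ ow ow′
                  ok″  = isOrderedPair-resp (≈.sym k≈k′) ≈.refl ≈.refl ok′ in
              resp (Clauseᵈ (con m) v0 v1 v2)
                ( orderedPair-injectiveˡ ow ow′ , orderedPair-injectiveˡ ok ok″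
                , orderedPair-injectiveʳ ok ok″ , tt) clause)
        in k , ok , w , ow , ⊆-maximal m⁺ bis⁺ (λ w′ → proj₁ ∘ to (im⁺ w′)) w w∈m⁺

  -- p ⊩ ⟨u,v⟩ˇ ∈ τ, witnessed by an element ⟨π,q⟩ of τ.
  Decides : U → U → U → U → Set ℓ
  Decides τ p u v = ∃[ π ] ∃[ q ] ∃[ p₁ ] ∃[ k ]
    (⟨ π , q ⟩∈ τ × p ≤ q × p ≤ p₁ × IsOrderedPair k u v × ForcesEq p₁ π k)

  -- Uniqueness is built in because no condition forcing that τ is a function is
  -- singled out.
  Settles : U → U → U → U → Set ℓ
  Settles τ p u v = Decides τ p u v × (∀ r v′ → r ≤ p → Decides τ r u v′ → v′ ≈ v)

  opaque
    Decidesᵈ : ∀ τ → Definable₃ (Decides τ)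
    Decidesᵈ τ p u v = ∃ᵈ ∃ᵈ ∃ᵈ ∃ᵈ ((⟨ v3 , v2 ⟩∈ᵈ con τ) ×ᵈ wk⁴ p ≤ᵈ v2 ×ᵈ wk⁴ p ≤ᵈ v1
      ×ᵈ IsOrderedPairᵈ v0 (wk⁴ u) (wk⁴ v) ×ᵈ ForcesEqᵈ v1 v3 v0)
      where
      wk⁴ : {f : Env n → U} → Term f → Term {4 + n} (λ ρ → f (proj₂ (proj₂ (proj₂ (proj₂ ρ)))))
      wk⁴ t = wk (wk (wk (wk t)))

  opaque
    Settlesᵈ : ∀ τ → Definable₃ (Settles τ)
    Settlesᵈ τ p u v = Decidesᵈ τ p u v
      ×ᵈ (∀ᵈ ∀ᵈ (v1 ≤ᵈ wk (wk p) →ᵈ Decidesᵈ τ v1 (wk (wk u)) v0 →ᵈ v0 ≈ᵈ wk (wk v)))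

  decides-mono : ∀ {τ p r u v} → r ≤ p → Decides τ p u v → Decides τ r u v
  decides-mono r≤p (π , q , p₁ , k , πq , p≤q , p≤p₁ , rest) =
    π , q , p₁ , k , πq , ≤-trans _ _ _ r≤p p≤q , ≤-trans _ _ _ r≤p p≤p₁ , rest

  settles-mono : ∀ {τ p r u v} → r ≤ p → Settles τ p u v → Settles τ r u v
  settles-mono r≤p (d , unique) =
    decides-mono r≤p d , λ s v′ s≤r → unique s v′ (≤-trans _ _ _ s≤r r≤p)

  settles-unique : ∀ {τ p u v v′} → p ∈ P → Settles τ p u v → Settles τ p u v′ → v ≈ v′
  settles-unique p∈P (d , _) (_ , unique) = unique _ _ (≤-refl _ p∈P) d

  -- Counting the values of a monotone, single-valued relation on conditions

  module PossibleValues (Q : U → U → U → Set ℓ) (Qᵈ : Definable₃ Q)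
    (Q-mono : ∀ {p r u v} → r ≤ p → Q p u v → Q r u v)
    (Q-unique : ∀ {p u v v′} → p ∈ P → Q p u v → Q p u v′ → v ≈ v′) where

    IsValueSet : U → U → Set ℓ
    IsValueSet u y = ∀ v → v ∈ y ⇔ (∃[ p ] (p ∈ P × Q p u v))

    opaque
      -- By uniqueness a condition determines at most one value, so Replacement over `P` makes the
      -- values at `u` a set; a second Replacement, in `graph`, collects these sets into a function.
      valueFunction : ∀ x → ∃[ g ] (IsFunctionOn g x × (∀ u y → ⟨ u , y ⟩∈ g → u ∈ x × IsValueSet u y))
      valueFunction x = graph {IsValueSet}
        (λ u y → ∀ᵈ (v0 ∈ᵈ wk y ⇔ᵈ (∃ᵈ (v0 ∈ᵈ con P ×ᵈ Qᵈ v0 (wk (wk u)) v1)))) x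
        (λ u _ → replace (Qᵈ v0 (con u) v1) P (λ p v v′ p∈P → Q-unique p∈P))
        (λ u y y′ _ p q → extensionality y y′ λ w → ⇔-sym (q w) ⇔-∘ p w)

    module _ (u y : U) (isValueSet : IsValueSet u y) where

      Settled : U → Set ℓ
      Settled p = (∃[ v ] Q p u v) ⊎ (∀ q → q ≤ p → ¬ (∃[ v ] Q q u v))

      opaque
        -- The set is even dense: a condition with no extension of the first kind is itself of the
        -- second kind.
        settled-predense : ∃[ D ] (Predense D × (∀ p → p ∈ D → Settled p))
        settled-predense =
          let (D , iD) = separate {Settled} ((∃ᵈ Qᵈ v1 (con u) v0)
                           ⊎ᵈ (∀ᵈ (v0 ≤ᵈ v1 →ᵈ ¬ᵈ (∃ᵈ Qᵈ v1 (con u) v0)))) P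
          in D , ((λ p p∈D → proj₁ (to (iD p) p∈D)) , λ p p∈P → predense D iD p p∈P)
               , λ p p∈D → proj₂ (to (iD p) p∈D)
          where
          predense : ∀ D → (∀ z → z ∈ D ⇔ (z ∈ P × Settled z)) →
                     ∀ p → p ∈ P → ∃[ d ] (d ∈ D × Compatible p d)
          predense D iD p p∈P with em {∃[ q ] (q ≤ p × ∃[ v ] Q q u v)}
          ... | yes (q , q≤p , w) = let q∈P = ≤-domˡ q≤p in
            q , from (iD q) (q∈P , inj₁ w) , q , q∈P , q≤p , ≤-refl q q∈P
          ... | no none = p , from (iD p) (p∈P , inj₂ λ q q≤p w → none (q , q≤p , w))
            , p , p∈P , ≤-refl p p∈P , ≤-refl p p∈P

      -- A common extension `r` of `p` and `c` inherits the value of `p`, so `c` is not of the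
      -- second kind; `r` also inherits the value of `c`, and the two agree.
      value-attained : ∀ {C} → Predense C → (∀ p → p ∈ C → Settled p) →
                       ∀ v → v ∈ y → ∃[ c ] (c ∈ C × Q c u v)
      value-attained (C⊆P , pre) settled v v∈y with to (isValueSet v) v∈y
      ... | p , p∈P , q with pre p p∈P
      ... | c , c∈C , r , r∈P , r≤p , r≤c with settled c c∈C
      ... | inj₁ (v′ , q′) = c , c∈C ,
        resp (Qᵈ (con c) (con u) v0) (Q-unique r∈P (Q-mono r≤c q′) (Q-mono r≤p q) , tt) q′
      ... | inj₂ none = ⊥-elim (none r r≤c (v , Q-mono r≤p q))

      module _ {C ω j : U} (C⊆P : C ⊆ P) (isω : IsOmega ω) (inj : IsInjection j C ω)
               (attained : ∀ v → v ∈ y → ∃[ c ] (c ∈ C × Q c u v)) where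

        module j = IsInjection inj
        module jf = IsFunctionOn j.isFunctionOn

        Index : U → U → Set ℓ
        Index v i = i ∈ ω × ∃[ c ] (c ∈ C × Q c u v × ⟨ c , i ⟩∈ j)

        -- `Countable` asks for an injection into ω, so every value must select one index among
        -- those of the conditions attaining it.
        LeastIndex : U → U → Set ℓ
        LeastIndex v i = Index v i × (∀ i′ → i′ ∈ i → ¬ Index v i′)

        opaque
          Indexᵈ : Definable₂ Index
          Indexᵈ v i = i ∈ᵈ con ω ×ᵈ (∃ᵈ (v0 ∈ᵈ con C ×ᵈ Qᵈ v0 (con u) (wk v) ×ᵈ (⟨ v0 , wk i ⟩∈ᵈ con j)))

          LeastIndexᵈ : Definable₂ LeastIndex
          LeastIndexᵈ v i = Indexᵈ v i ×ᵈ (∀ᵈ (v0 ∈ᵈ wk i →ᵈ ¬ᵈ (Indexᵈ (wk v) v0)))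

        leastIndex-exists : ∀ v → v ∈ y → ∃[ i ] LeastIndex v i
        leastIndex-exists v v∈y =
          let (c , c∈C , q)  = attained v v∈y
              (i , w)        = jf.total c c∈C
              i∈ω            = j.range c i w
              (I , iI)       = separate (Indexᵈ (con v) v0) ω
              (l , l∈I , min) = foundation I (i , from (iI i) (i∈ω , i∈ω , c , c∈C , q , w))
          in l , proj₂ (to (iI l) l∈I) ,
             λ i′ i′∈l idx → min i′ (from (iI i′) (proj₁ idx , idx)) i′∈l

        leastIndex-unique : ∀ v i i′ → LeastIndex v i → LeastIndex v i′ → i ≈ i′
        leastIndex-unique v i i′ (idx , min) (idx′ , min′)
          with ω-trichotomy isω i (proj₁ idx) i′ (proj₁ idx′)
        ... | inj₁ i∈i′        = ⊥-elim (min′ i i∈i′ idx)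
        ... | inj₂ (inj₁ e)    = e
        ... | inj₂ (inj₂ i′∈i) = ⊥-elim (min i′ i′∈i idx′)

        -- An index determines its condition, as `j` is injective, and a condition determines its
        -- value.
        index-injective : ∀ v v′ i → Index v i → Index v′ i → v ≈ v′
        index-injective v v′ i (_ , c , c∈C , q , w) (_ , c′ , c′∈C , q′ , w′) =
          Q-unique (C⊆P c c∈C) q
            (resp (Qᵈ v0 (con u) (con v′)) (j.injective c′ c i w′ w , tt) q′)

        valueSet-injection : ∃[ F ] IsInjection F y ω
        valueSet-injection =
          let (F , isFun , elim) = graph LeastIndexᵈ y leastIndex-exists
                                     (λ v i i′ _ → leastIndex-unique v i i′)
          in F , record
            { isFunctionOn = isFun
            ; range        = λ v i w → proj₁ (proj₁ (proj₂ (elim v i w)))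
            ; injective    = λ v v′ i w w′ → index-injective v v′ i
                (proj₁ (proj₂ (elim v i w))) (proj₁ (proj₂ (elim v′ i w′))) }

      valueSet-countable : CCC₃ → Countable y
      valueSet-countable ccc =
        let (D , pre , settled) = settled-predense
            (C , C⊆D , (ω , j , isω , inj) , preC) = ccc D pre
        in ω , _ , isω , proj₂ (valueSet-injection (proj₁ preC) isω inj
             (value-attained preC (λ p p∈C → settled p (C⊆D p p∈C))))

-- Genericity below a condition

module GenericFilter (em : ExcludedMiddle ℓ) (V : Structure ℓ) (zf : SetTheory.IsZF V)
  (ℙ : ForcingNotion V) (G : Pred (Structure.Carrier V) ℓ) (isGeneric : IsGenericFilter V ℙ G) where

  open ZF V zf
  open ForcingNotion ℙ
  open IsGenericFilter isGeneric
  open Forcing em V zf ℙ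

  opaque
    -- Genericity concerns sets dense in all of `P`, so the conditions incompatible with `p` are
    -- added; none of them can belong to the filter.
    meets-dense-below : {Q : U → Set ℓ} → Def₁ Q → ∀ p → G p →
                        (∀ r → r ≤ p → ∃[ r′ ] (r′ ≤ r × Q r′)) → ∃[ r ] (G r × Q r)
    meets-dense-below {Q} d p Gp dense =
      let (D , iD) = separate (d ⊎ᵈ (∀ᵈ (v0 ≤ᵈ v1 →ᵈ ¬ᵈ (v0 ≤ᵈ con p)))) P
          (r , r∈D , Gr) = generic D ((λ z z∈D → proj₁ (to (iD z) z∈D)) , D-dense D iD)
      in r , Gr , [ id , (λ incompatible → let (s , _ , s≤p , s≤r) = directed p r Gp Gr in
                            ⊥-elim (incompatible s s≤r s≤p)) ]′ (proj₂ (to (iD r) r∈D))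
      where
      D-dense : ∀ D → (∀ z → z ∈ D ⇔ (z ∈ P × (Q z ⊎ (∀ s → s ≤ z → ¬ (s ≤ p))))) →
                ∀ s → s ∈ P → ∃[ r ] (r ∈ D × r ≤ s)
      D-dense D iD s s∈P with em {∃[ r ] (r ≤ s × r ≤ p)}
      ... | yes (r , r≤s , r≤p) = let (r′ , r′≤r , q) = dense r r≤p in
        r′ , from (iD r′) (≤-domˡ r′≤r , inj₁ q) , ≤-trans r′ r s r′≤r r≤s
      ... | no none = s , from (iD s) (s∈P , inj₂ λ r r≤s r≤p → none (r , r≤s , r≤p)) , ≤-refl s s∈P

-- Absoluteness between V and W, and induction over V

module Absoluteness (em : ExcludedMiddle ℓ) (V : Structure ℓ) (zf : SetTheory.IsZF V)
                    (E : Extension V) where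

  open Extension E
  module V = ZF V zf
  module W = ZF W isZF

  ι-isPair : ∀ {z a b} → V.IsPair z a b → W.IsPair (ι z) (ι a) (ι b)
  ι-isPair {z} {a} {b} p w = mk⇔
    (λ w∈z → let (y , w≈y) = transitive w z w∈z
                 y∈z = from (ι-∈ y z) (W.∈-respˡ w≈y w∈z) in
             [ (λ e → inj₁ (W.≈.trans w≈y (to (ι-≈ y a) e)))
             , (λ e → inj₂ (W.≈.trans w≈y (to (ι-≈ y b) e))) ]′ (to (p y) y∈z))
    [ (λ e → W.∈-respˡ (W.≈.sym e) (to (ι-∈ a z) (V.isPair-left p)))
    , (λ e → W.∈-respˡ (W.≈.sym e) (to (ι-∈ b z) (V.isPair-right p))) ]′

  ι-isOrderedPair : ∀ {z a b} → V.IsOrderedPair z a b → W.IsOrderedPair (ι z) (ι a) (ι b)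
  ι-isOrderedPair (s , t , ps , pt , pz) = ι s , ι t , ι-isPair ps , ι-isPair pt , ι-isPair pz

  opaque
    -- Both components are elements of an element of `ι z`, so transitivity brings them into V.
    ι-isOrderedPair⁻ : ∀ {z a b} → W.IsOrderedPair (ι z) a b →
      ∃[ a′ ] ∃[ b′ ] (a W.≈ ι a′ × b W.≈ ι b′ × V.IsOrderedPair z a′ b′)
    ι-isOrderedPair⁻ {z} {a} {b} oz@(s , t , ps , pt , pz) =
      let (t′ , t≈t′) = transitive t z (W.isPair-right pz)
          (a′ , a≈a′) = transitive a t′ (W.∈-respʳ t≈t′ (W.isPair-left pt))
          (b′ , b≈b′) = transitive b t′ (W.∈-respʳ t≈t′ (W.isPair-right pt))
          (k , ok)    = V.orderedPair a′ b′
          k≈z         = from (ι-≈ k z) (W.orderedPair-unique (ι-isOrderedPair ok)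
                          (W.isOrderedPair-resp W.≈.refl a≈a′ b≈b′ oz))
      in a′ , b′ , a≈a′ , b≈b′ , V.isOrderedPair-resp k≈z V.≈.refl V.≈.refl ok

  ι-⟨⟩∈ : ∀ {a b r} → V.⟨ a , b ⟩∈ r → W.⟨ ι a , ι b ⟩∈ ι r
  ι-⟨⟩∈ {r = r} (z , oz , z∈r) = ι z , ι-isOrderedPair oz , to (ι-∈ z r) z∈r

  opaque
    ι-⟨⟩∈⁻ : ∀ {a b r} → W.⟨ a , b ⟩∈ ι r →
      ∃[ a′ ] ∃[ b′ ] (a W.≈ ι a′ × b W.≈ ι b′ × V.⟨ a′ , b′ ⟩∈ r)
    ι-⟨⟩∈⁻ {r = r} (z , oz , z∈r) =
      let (z′ , z≈z′) = transitive z r z∈r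
          (a′ , b′ , a≈a′ , b≈b′ , oz′) =
            ι-isOrderedPair⁻ (W.isOrderedPair-resp z≈z′ W.≈.refl W.≈.refl oz)
      in a′ , b′ , a≈a′ , b≈b′ , z′ , oz′ , from (ι-∈ z′ r) (W.∈-respˡ z≈z′ z∈r)

  ι-triple : ∀ {e p σ z} → V.Triple e p σ z → W.Triple (ι e) (ι p) (ι σ) (ι z)
  ι-triple (k , ok , w) = ι k , ι-isOrderedPair ok , ι-⟨⟩∈ w

  opaque
    ι-triple⁻ : ∀ {e p σ z} → W.Triple (ι e) p σ z →
      ∃[ p′ ] ∃[ σ′ ] ∃[ z′ ] (p W.≈ ι p′ × σ W.≈ ι σ′ × z W.≈ ι z′ × V.Triple e p′ σ′ z′)
    ι-triple⁻ (k , ok , w) =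
      let (p′ , k′ , p≈p′ , k≈k′ , w′) = ι-⟨⟩∈⁻ w
          (σ′ , z′ , σ≈σ′ , z≈z′ , ok′) =
            ι-isOrderedPair⁻ (W.isOrderedPair-resp k≈k′ W.≈.refl W.≈.refl ok)
      in p′ , σ′ , z′ , p≈p′ , σ≈σ′ , z≈z′ , k′ , ok′ , w′

  -- V need not be definable in W, so ∈-induction is available only for
  -- predicates on V induced by definable predicates of W.
  ι-induction : {Q : V.U → Set ℓ} {R : W.U → Set ℓ} → W.Def₁ R → (∀ z → Q z ⇔ R (ι z)) →
    ∀ {s} → V.IsTransitive s →
    (∀ z → z V.∈ s → (∀ y → y V.∈ z → Q y) → Q z) → ∀ z → z V.∈ s → Q z
  ι-induction {Q} {R} d eq {s} tr step z z∈s with em {Q z}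
  ... | yes q = q
  ... | no ¬q =
    -- The counterexamples in `s` form a set of W; a minimal one comes from V by transitivity.
    let (B , iB) = W.separate (W.¬ᵈ d) (ι s)
        bad : ∀ y → y V.∈ s → ¬ Q y → ι y W.∈ B
        bad y y∈s ¬qy = from (iB (ι y)) (to (ι-∈ y s) y∈s , ¬qy ∘ from (eq y))
        (w , w∈B , min) = W.foundation B (ι z , bad z z∈s ¬q)
        (w∈s , ¬r)      = to (iB w) w∈B
        (y , w≈y)       = transitive w s w∈s
        y∈s             = from (ι-∈ y s) (W.∈-respˡ w≈y w∈s)
    in ⊥-elim (¬r (W.resp d (W.≈.sym w≈y , tt) (to (eq y) (step y y∈s (λ x x∈y →
         decidable-stable em λ ¬qx → min (ι x) (bad x (tr y x y∈s x∈y) ¬qx)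
                           (W.∈-respʳ (W.≈.sym w≈y) (to (ι-∈ x y) x∈y)))))))

-- The truth lemma for σ = ž

module Truth (em : ExcludedMiddle ℓ) (V : Structure ℓ) (zf : SetTheory.IsZF V)
  (ℙ : ForcingNotion V) (G : Pred (Structure.Carrier V) ℓ) (isGeneric : IsGenericFilter V ℙ G)
  (V[G] : GenericExtension V ℙ G) where

  open GenericExtension V[G]
  open Absoluteness em V zf extension public
  open ForcingNotion ℙ
  open IsGenericFilter isGeneric
  open Forcing em V zf ℙ
  open GenericFilter em V zf ℙ G isGeneric

  ι∈Ĝ : ∀ {p} → G p → ι p W.∈ Ĝ
  ι∈Ĝ {p} Gp = from (Ĝ-spec (ι p)) (p , Gp , W.≈.refl)

  ∈Ĝ⁻ : ∀ {w p} → w W.≈ ι p → w W.∈ Ĝ → G p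
  ∈Ĝ⁻ {w} {p} w≈p w∈Ĝ = let (p′ , Gp′ , w≈p′) = to (Ĝ-spec w) w∈Ĝ in
    resp-≈ (from (ι-≈ p′ p) (W.≈.trans (W.≈.sym w≈p′) w≈p)) Gp′

  module Evaluation {d h : W.U}
    (closed : ∀ s σ p → s W.∈ d → W.⟨ σ , p ⟩∈ s → σ W.∈ d)
    (isFunctionOn : W.IsFunctionOn h d)
    (recursion : ∀ s y → W.⟨ s , y ⟩∈ h → ∀ v →
       v W.∈ y ⇔ (∃[ σ ] ∃[ p ] (W.⟨ σ , p ⟩∈ s × p W.∈ Ĝ × W.⟨ σ , v ⟩∈ h))) where

    open W.IsFunctionOn isFunctionOn using (total) renaming (relation to h-relation)

    opaque
      value-elim : ∀ {σ y v} → W.⟨ ι σ , y ⟩∈ h → v W.∈ y →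
                   ∃[ π ] ∃[ q ] (V.⟨ π , q ⟩∈ σ × G q × W.⟨ ι π , v ⟩∈ h)
      value-elim {σ} {y} {v} σy v∈y =
        let (π , q , πq , q∈Ĝ , πv) = to (recursion (ι σ) y σy v) v∈y
            (π′ , q′ , π≈π′ , q≈q′ , πq′) = ι-⟨⟩∈⁻ πq
        in π′ , q′ , πq′ , ∈Ĝ⁻ q≈q′ q∈Ĝ , W.⟨⟩∈-resp π≈π′ W.≈.refl πv

    value-intro : ∀ {σ y v π q} → W.⟨ ι σ , y ⟩∈ h → V.⟨ π , q ⟩∈ σ → G q →
                  W.⟨ ι π , v ⟩∈ h → v W.∈ y
    value-intro {σ} {y} {v} {π} {q} σy πq Gq πv =
      from (recursion (ι σ) y σy v) (ι π , ι q , ι-⟨⟩∈ πq , ι∈Ĝ Gq , πv)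

    opaque
      value-exists : ∀ {σ y π q} → W.⟨ ι σ , y ⟩∈ h → V.⟨ π , q ⟩∈ σ → ∃[ v ] W.⟨ ι π , v ⟩∈ h
      value-exists {σ} {y} {π} {q} (k , ok , k∈h) πq =
        let (σ′ , _ , σ′∈d , ok′) = h-relation k k∈h
            σ∈d = W.∈-respˡ (W.orderedPair-injectiveˡ ok′ ok) σ′∈d
        in total (ι π) (closed (ι σ) (ι π) (ι q) σ∈d (ι-⟨⟩∈ πq))

    module _ (e : V.U) where

      Sound : V.U → Set ℓ
      Sound z = ∀ p σ y → G p → V.Triple e p σ z → W.⟨ ι σ , y ⟩∈ h → y W.≈ ι z

      -- Quantifying `p` and `σ` over W instead of V changes nothing, since the components of a
      -- triple in `ι e` come from V.
      Soundᵂ : W.U → Set ℓ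
      Soundᵂ z = ∀ p σ y → p W.∈ Ĝ → W.Triple (ι e) p σ z → W.⟨ σ , y ⟩∈ h → y W.≈ z

      opaque
        Soundᵂᵈ : W.Def₁ Soundᵂ
        Soundᵂᵈ = ∀ᵈ ∀ᵈ ∀ᵈ (v2 ∈ᵈ con Ĝ →ᵈ Tripleᵈ (con (ι e)) v2 v1 v3 →ᵈ
                            ⟨ v1 , v0 ⟩∈ᵈ con h →ᵈ v0 ≈ᵈ v3)
          where open W

      sound⇔ : ∀ z → Sound z ⇔ Soundᵂ (ι z)
      sound⇔ z = mk⇔
        (λ f p σ y p∈Ĝ tr σy →
          let (p′ , σ′ , z′ , p≈p′ , σ≈σ′ , z≈z′ , tr′) = ι-triple⁻ tr in
          f p′ σ′ y (∈Ĝ⁻ p≈p′ p∈Ĝ)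
            (V.triple-resp V.≈.refl V.≈.refl (from (ι-≈ z′ z) (W.≈.sym z≈z′)) tr′)
            (W.⟨⟩∈-resp σ≈σ′ W.≈.refl σy))
        (λ f p σ y Gp tr σy → f (ι p) (ι σ) y (ι∈Ĝ Gp) (ι-triple tr) σy)

      module _ (bis : IsBisimulation e) where

        -- Each half of the clause gives one inclusion: genericity turns density into a condition in
        -- G, and the induction hypothesis evaluates the name that it supplies.
        sound-step : ∀ z → (∀ y → y V.∈ z → Sound y) → Sound z
        sound-step z ih p σ y Gp tr σy = W.extensionality y (ι z) λ v → mk⇔ ⊆ι ι⊆
          where
          ⊆ι : ∀ {v} → v W.∈ y → v W.∈ ι z
          ⊆ι {v} v∈y =
            let (π , q , πq , Gq , πv) = value-elim σy v∈y
                (r , Gr , r≤p , r≤q)   = directed p q Gp Gq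
                (r′ , Gr′ , x , p′ , x∈z , tr′ , r′≤p′) =
                  meets-dense-below (ForcesInᵈ (V.con e) (V.con z) (V.con π) V.v0) r Gr
                    (λ s s≤r → proj₁ (bis p σ z tr) π q πq s
                                 (≤-trans s r p s≤r r≤p) (≤-trans s r q s≤r r≤q))
                v≈x = ih x x∈z p′ π v (upward r′ p′ Gr′ r′≤p′) tr′ πv
            in W.∈-respˡ (W.≈.sym v≈x) (to (ι-∈ x z) x∈z)
          ι⊆ : ∀ {v} → v W.∈ ι z → v W.∈ y
          ι⊆ {v} v∈z =
            let (x , v≈x) = transitive v z v∈z
                x∈z = from (ι-∈ x z) (W.∈-respˡ v≈x v∈z)
                (r′ , Gr′ , π , q , p′ , πq , tr′ , r′≤q , r′≤p′) =
                  meets-dense-below (ForcesHasᵈ (V.con e) (V.con σ) (V.con x) V.v0) p Gp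
                    (proj₂ (bis p σ z tr) x x∈z)
                (w , πw) = value-exists σy πq
                w≈x = ih x x∈z p′ π w (upward r′ p′ Gr′ r′≤p′) tr′ πw
            in W.∈-respˡ (W.≈.trans w≈x (W.≈.sym v≈x))
                 (value-intro σy πq (upward r′ q Gr′ r′≤q) πw)

        sound : ∀ z → Sound z
        sound z = let (s , z∈s , tr) = V.transitive-∋ z in
          ι-induction Soundᵂᵈ sound⇔ tr (λ x _ → sound-step x) z z∈s

      module _ (t : V.U) where

        -- A fixed `e` replaces `ForcesEq`, whose existential quantifier over V could not be
        -- expressed in W; `t` bounds the names accordingly.
        Complete : V.U → Set ℓ
        Complete z = ∀ σ → σ V.∈ t → W.⟨ ι σ , ι z ⟩∈ h → ∃[ p ] (G p × V.Triple e p σ z)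

        Completeᵂ : W.U → Set ℓ
        Completeᵂ z = ∀ σ → σ W.∈ ι t → W.⟨ σ , z ⟩∈ h → ∃[ p ] (p W.∈ Ĝ × W.Triple (ι e) p σ z)

        opaque
          Completeᵂᵈ : W.Def₁ Completeᵂ
          Completeᵂᵈ = ∀ᵈ (v0 ∈ᵈ con (ι t) →ᵈ ⟨ v0 , v1 ⟩∈ᵈ con h →ᵈ
                           ∃ᵈ (v0 ∈ᵈ con Ĝ ×ᵈ Tripleᵈ (con (ι e)) v0 v1 v2))
            where open W

        complete⇔ : ∀ z → Complete z ⇔ Completeᵂ (ι z)
        complete⇔ z = mk⇔ to′ from′
          where
          to′ : Complete z → Completeᵂ (ι z)
          to′ f σ σ∈t σz =
            let (σ′ , σ≈σ′) = transitive σ t σ∈t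
                (p , Gp , tr) = f σ′ (from (ι-∈ σ′ t) (W.∈-respˡ σ≈σ′ σ∈t))
                                     (W.⟨⟩∈-resp σ≈σ′ W.≈.refl σz)
            in ι p , ι∈Ĝ Gp , W.triple-resp W.≈.refl (W.≈.sym σ≈σ′) W.≈.refl (ι-triple tr)
          from′ : Completeᵂ (ι z) → Complete z
          from′ f σ σ∈t σz =
            let (p , p∈Ĝ , tr) = f (ι σ) (to (ι-∈ σ t) σ∈t) σz
                (p′ , σ′ , z′ , p≈p′ , σ≈σ′ , z≈z′ , tr′) = ι-triple⁻ tr
            in p′ , ∈Ĝ⁻ p≈p′ p∈Ĝ , V.triple-resp V.≈.refl (from (ι-≈ σ′ σ) (W.≈.sym σ≈σ′))
                                      (from (ι-≈ z′ z) (W.≈.sym z≈z′)) tr′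

        -- With `OmitsHas`, the ways to refute `Clause`: here π is put into σ by `p`, yet nothing
        -- below `p` visibly forces π ∈ ž.
        OmitsIn : V.U → V.U → V.U → Set ℓ
        OmitsIn σ z p = ∃[ π ] ∃[ q ] (V.⟨ π , q ⟩∈ σ × p ≤ q × (∀ r → r ≤ p → ¬ ForcesIn e z π r))

        OmitsHas : V.U → V.U → V.U → Set ℓ
        OmitsHas σ z p = ∃[ y ] (y V.∈ z × (∀ r → r ≤ p → ¬ ForcesHas e σ y r))

        Verdict : V.U → V.U → V.U → Set ℓ
        Verdict σ z p = V.Triple e p σ z ⊎ OmitsIn σ z p ⊎ OmitsHas σ z p

        opaque
          Verdictᵈ : ∀ σ z → V.Def₁ (Verdict σ z)
          Verdictᵈ σ z = Tripleᵈ (con e) v0 (con σ) (con z)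
            ⊎ᵈ (∃ᵈ ∃ᵈ ((⟨ v1 , v0 ⟩∈ᵈ con σ) ×ᵈ v2 ≤ᵈ v0
                  ×ᵈ (∀ᵈ (v0 ≤ᵈ v3 →ᵈ ¬ᵈ (ForcesInᵈ (con e) (con z) v2 v0)))))
            ⊎ᵈ (∃ᵈ (v0 ∈ᵈ con z ×ᵈ (∀ᵈ (v0 ≤ᵈ v2 →ᵈ ¬ᵈ (ForcesHasᵈ (con e) (con σ) v1 v0)))))
            where open V

        module _ (t-closed : ∀ {σ π q} → σ V.∈ t → V.⟨ π , q ⟩∈ σ → π V.∈ t) {s : V.U}
          (maximal : ∀ p σ z → p V.∈ P → σ V.∈ t → z V.∈ s → Clause e p σ z → V.Triple e p σ z) where

          -- If no extension of `p` omits anything, both halves of the clause hold at `p`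
          -- classically, and maximality puts the triple into `e`.
          verdict-dense : ∀ {σ z} → σ V.∈ t → z V.∈ s → ∀ p → p V.∈ P →
                          ∃[ r ] (r ≤ p × Verdict σ z r)
          verdict-dense {σ} {z} σ∈t z∈s p p∈P
            with em {∃[ r ] (r ≤ p × OmitsIn σ z r)} | em {∃[ r ] (r ≤ p × OmitsHas σ z r)}
          ... | yes (r , r≤p , o) | _ = r , r≤p , inj₂ (inj₁ o)
          ... | no _ | yes (r , r≤p , o) = r , r≤p , inj₂ (inj₂ o)
          ... | no noIn | no noHas = p , ≤-refl p p∈P , inj₁ (maximal p σ z p∈P σ∈t z∈s
            ( (λ π q πq r r≤p r≤q → decidable-stable em λ none →
                 noIn (r , r≤p , π , q , πq , r≤q , λ r′ r′≤r w → none (r′ , r′≤r , w)))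
            , (λ y y∈z r r≤p → decidable-stable em λ none →
                 noHas (r , r≤p , y , y∈z , λ r′ r′≤r w → none (r′ , r′≤r , w)))))

          -- G contains a condition with a verdict. If it omitted something, the induction
          -- hypothesis would give `p′` in G forcing the actual value of the relevant name π, and a
          -- common extension would contradict the omission.
          complete-step : ∀ z → z V.∈ s → (∀ y → y V.∈ z → Complete y) → Complete z
          complete-step z z∈s ih σ σ∈t σz =
            let (p₀ , Gp₀) = nonempty
                (p , Gp , verdict) = meets-dense-below (Verdictᵈ σ z) p₀ Gp₀
                  (λ r r≤p₀ → verdict-dense σ∈t z∈s r (≤-domˡ r≤p₀))
            in p , Gp , [ id , [ ⊥-elim ∘ ¬omitsIn p Gp , ⊥-elim ∘ ¬omitsHas p Gp ]′ ]′ verdict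
            where
            ¬omitsIn : ∀ p → G p → ¬ OmitsIn σ z p
            ¬omitsIn p Gp (π , q , πq , p≤q , omits) =
              let Gq = upward p q Gp p≤q
                  (v , πv) = value-exists σz πq
                  v∈z = value-intro σz πq Gq πv
                  (y , v≈y) = transitive v z v∈z
                  y∈z = from (ι-∈ y z) (W.∈-respˡ v≈y v∈z)
                  (p′ , Gp′ , tr) = ih y y∈z π (t-closed σ∈t πq) (W.⟨⟩∈-resp W.≈.refl v≈y πv)
                  (r , _ , r≤p , r≤p′) = directed p p′ Gp Gp′
              in omits r r≤p (y , p′ , y∈z , tr , r≤p′)
            ¬omitsHas : ∀ p → G p → ¬ OmitsHas σ z p
            ¬omitsHas p Gp (y , y∈z , omits) =
              let (π , q , πq , Gq , πy) = value-elim σz (to (ι-∈ y z) y∈z)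
                  (p′ , Gp′ , tr) = ih y y∈z π (t-closed σ∈t πq) πy
                  (r , Gr , r≤p , r≤p′) = directed p p′ Gp Gp′
                  (r′ , _ , r′≤r , r′≤q) = directed r q Gr Gq
              in omits r′ (≤-trans r′ r p r′≤r r≤p)
                   (π , q , p′ , πq , tr , r′≤q , ≤-trans r′ r p′ r′≤r r≤p′)

    complete : ∀ {t} → (∀ {σ π q} → σ V.∈ t → V.⟨ π , q ⟩∈ σ → π V.∈ t) →
               ∀ σ z → σ V.∈ t → W.⟨ ι σ , ι z ⟩∈ h → ∃[ p ] (G p × ForcesEq p σ z)
    complete {t} t-closed σ z σ∈t σz =
      let (s , z∈s , tr) = V.transitive-∋ z
          (e , bis , maximal) = maximal-bisimulation t s
          (p , Gp , tri) = ι-induction (Completeᵂᵈ e t) (complete⇔ e t) tr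
                             (complete-step e t t-closed maximal) z z∈s σ σ∈t σz
      in p , Gp , e , bis , tri

    module _ (τ : V.U) {f : W.U} (τf : W.⟨ ι τ , f ⟩∈ h) where

      decides-sound : ∀ {p u v} → G p → Decides τ p u v → W.⟨ ι u , ι v ⟩∈ f
      decides-sound {p} Gp (π , q , p₁ , k , πq , p≤q , p≤p₁ , ok , e , bis , tri) =
        let (w , πw) = value-exists τf πq
            w≈k = sound e bis k p₁ π w (upward p p₁ Gp p≤p₁) tri πw
        in ι k , ι-isOrderedPair ok , W.∈-respˡ w≈k (value-intro τf πq (upward p q Gp p≤q) πw)

      module _ {t : V.U} (τ∈t : τ V.∈ t)
               (t-closed : ∀ {σ π q} → σ V.∈ t → V.⟨ π , q ⟩∈ σ → π V.∈ t) where

        decides-complete : ∀ {u v} → W.⟨ ι u , ι v ⟩∈ f → ∃[ p ] (G p × Decides τ p u v)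
        decides-complete {u} {v} uv =
          let (k , ok) = V.orderedPair u v
              (π , q , πq , Gq , πk) = value-elim τf (W.⟨⟩∈-elim (ι-isOrderedPair ok) uv)
              (p₁ , Gp₁ , forces) = complete t-closed π k (t-closed τ∈t πq) πk
              (p , Gp , p≤q , p≤p₁) = directed q p₁ Gq Gp₁
          in p , Gp , π , q , p₁ , k , πq , p≤q , p≤p₁ , ok , forces

        -- Below a condition deciding the true value, each condition settles it or has an extension
        -- deciding another value. G meets this dense set, and the second case would, by soundness,
        -- give `f` two values at `u`.
        settles-complete : ∀ {u v} → (∀ v′ → W.⟨ ι u , ι v′ ⟩∈ f → v′ V.≈ v) →
                           W.⟨ ι u , ι v ⟩∈ f → ∃[ p ] (G p × Settles τ p u v)
        settles-complete {u} {v} unique uv =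
          let (p₀ , Gp₀ , dec) = decides-complete uv
              (p , Gp , c) = meets-dense-below
                (Settlesᵈ τ V.v0 (V.con u) (V.con v)
                  V.⊎ᵈ (V.∃ᵈ (V.¬ᵈ (V.v0 V.≈ᵈ V.con v) V.×ᵈ Decidesᵈ τ V.v1 (V.con u) V.v0)))
                p₀ Gp₀ (λ r r≤p₀ → dense r (≤-domˡ r≤p₀) (decides-mono r≤p₀ dec))
          in p , Gp , [ id , (λ (v′ , v′≉v , dec′) → ⊥-elim (v′≉v (unique v′ (decides-sound Gp dec′)))) ]′ c
          where
          dense : ∀ r → r V.∈ P → Decides τ r u v →
                  ∃[ r′ ] (r′ ≤ r × (Settles τ r′ u v ⊎ ∃[ v′ ] (¬ (v′ V.≈ v) × Decides τ r′ u v′)))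
          dense r r∈P dec with em {∃[ r′ ] (r′ ≤ r × ∃[ v′ ] (¬ (v′ V.≈ v) × Decides τ r′ u v′))}
          ... | yes (r′ , r′≤r , w) = r′ , r′≤r , inj₂ w
          ... | no none = r , ≤-refl r r∈P , inj₁ (dec , λ r′ v′ r′≤r dec′ →
            decidable-stable em λ v′≉v → none (r′ , r′≤r , v′ , v′≉v , dec′))

-- Bukovský's condition from the settled values

proposition5p2 : ∀ {ℓ} → ExcludedMiddle ℓ →
    (V : Structure ℓ) → SetTheory.IsZF V →
    (ℙ : ForcingNotion V) → ForcingNotion.CCC₃ ℙ →
    (G : Pred (Structure.Carrier V) ℓ) → IsGenericFilter V ℙ G →
    (V[G] : GenericExtension V ℙ G) →
    Bukovský-ℵ₁ V (GenericExtension.extension V[G])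
proposition5p2 em V zf ℙ ccc G isGeneric V[G] x f isFun f⊆V =
  let (τ , (t , τ∈t , t-names) , d , h , closed , isFunH , recursion , _ , τf) = values f
      (g , isFunG , g-spec) = valueFunction τ x
  in g , isFunG , λ u y u∈x uy →
       let isValueSet = proj₂ (g-spec u y uy) in
       valueSet-countable τ u y isValueSet ccc , λ b ub →
         let (v , b≈v) = f⊆V (ι u) b ub
             uv = W.⟨⟩∈-resp W.≈.refl b≈v ub
             (p , Gp , settles) = Evaluation.settles-complete closed isFunH recursion τ τf τ∈t
               (λ {σ} {π} {q} → name-closed t t-names σ π q)
               -- Single-valuedness of `f` in W is reflected to V along `ι`.
               (λ v′ uv′ → from (ι-≈ v′ v) (unique (ι u) (ι v′) (ι v) uv′ uv)) uv
         in W.∈-respˡ (W.≈.sym b≈v) (to (ι-∈ v y) (from (isValueSet v) (p , subset p Gp , settles)))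
  where
  open GenericExtension V[G]
  open ForcingNotion ℙ using (P)
  open IsGenericFilter isGeneric using (subset)
  open Truth em V zf ℙ G isGeneric V[G]
  open Forcing em V zf ℙ
  open W.IsFunctionOn isFun using (unique)
  module _ (τ : V.U) where
    open PossibleValues (Settles τ) (Settlesᵈ τ) settles-mono settles-unique public
  name-closed : ∀ t → (∀ s → s V.∈ t → ∀ z → z V.∈ s →
                  ∃[ σ ] ∃[ p ] (σ V.∈ t × p V.∈ P × V.IsOrderedPair z σ p)) →
                ∀ σ π q → σ V.∈ t → V.⟨ π , q ⟩∈ σ → π V.∈ t
  name-closed t names σ π q σ∈t (z , oz , z∈σ) =
    let (π′ , _ , π′∈t , _ , oz′) = names σ σ∈t z z∈σ
    in V.∈-respˡ (V.orderedPair-injectiveˡ oz′ oz) π′∈t
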